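{- If $M'$ is obtained from the rank-$r$ matroid $M$ on an $n$-element set by relaxing a circuit-hyperplane, then $$\mathcal{G}(M')-\mathcal{G}(M)=r!\,(n-r)!\,\bigl([1^r0^{n-r}]-[1^{r-1}010^{n-r-1}]\bigr).$$ Equivalently, the only compositions for which $\nu(M;\cdot)$ and $\nu(M';\cdot)$ differ are the following: $$\nu(M';0,1,\ldots,1,n-r+1)=\nu(M;0,1,\ldots,1,n-r+1)+r!$$ and $$\nu(M';0,1,\ldots,1,2,n-r)=\nu(M;0,1,\ldots,1,2,n-r)-\frac{r!}{2}.$$
   Context: If $X$ is both a circuit and a hyperplane (flat of rank $r(M)-1$) of a matroid $M$, the corresponding circuit-hyperplane relaxation is the matroid on the same set whose bases are those of $M$ together with $X$. $\mathcal{G}(n,r)$ is the vector space over a field of characteristic zero with basis the formal symbols $[\underline{r}]$, one for each $0,1$-sequence of length $n$ with exactly $r$ ones; $0^a$ and $1^b$ denote runs of $a$ zeros and $b$ ones. For a rank-$r$ matroid $M$ with rank function $r(\cdot)$ on an $n$-element set $E$ and a permutation (linear ordering) $\pi$ of $E$, the rank sequence $\underline{r}(\pi)=r_1\ldots r_n$ has $r_j=r(\{\pi(1),\ldots,\pi(j)\})-r(\{\pi(1),\ldots,\pi(j-1)\})$. The $\mathcal{G}$-invariant is $\mathcal{G}(M)=\sum_\pi[\underline{r}(\pi)]\in\mathcal{G}(n,r)$, over all $n!$ permutations of $E$. An $(n,r)$-composition is an integer sequence $(a_0,\ldots,a_r)$ of length $r+1$ with $a_0\ge0$, $a_j>0$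 for $1\le j\le r$, and sum $n$; the compositions displayed in the claim are $(n,r)$-compositions, which fixes the number of ones in each. A flag of $M$ is a chain $X_0\subset X_1\subset\cdots\subset X_r=E$ of flats with $r(X_j)=j$; its composition is $(|X_0|,|X_1-X_0|,\ldots,|X_r-X_{r-1}|)$. $\nu(M;a_0,\ldots,a_r)$ is the number of flags of $M$ with composition $(a_0,\ldots,a_r)$.
   Formalization: The second formula for ν and the claim that no other compositions change are stated for r ≥ 2: for r = 1 the composition (0,1,…,1,2,n−r) does not exist and ν also changes at (1,n−1). The G-invariant identity and the first ν formula hold for all r. -}

module Defs where

open import Level using (0ℓ)
open import Algebra.Apartness.Bundles using (HeytingField; module HeytingCommutativeRing)
open import Algebra.Bundles using (AbelianGroup; CommutativeRing)
import Algebra.Construct.Pointwise as Pointwise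
import Algebra.Definitions.RawMonoid as RawMonoid
open import Algebra.Module.Bundles using (Module)
open import Algebra.Module.Structures.Biased using (IsModuleFromLeft)
open import Data.Bool.Base using (if_then_else_)
open import Data.Empty using (⊥-elim)
open import Data.Fin.Base using (Fin; zero; suc; toℕ)
import Data.Fin.Properties as Fin
open import Data.Fin.Subset
open import Data.Fin.Subset.Properties
open import Data.List.Base as List
  using (List; []; _∷_; _++_; length; map; foldr; filter; replicate; cartesianProductWith; allFin)
open import Data.List.Extrema.Nat using (max; xs≤max; argmax-sel)
import Data.List.Properties as List
open import Data.List.Relation.Unary.All as All using (All; []; _∷_)
open import Data.List.Relation.Unary.All.Properties as All using (all-filter)
open import Data.List.Relation.Unary.Any using (here; there)
import Data.List.Membership.Propositional as List
open import Data.List.Membership.Propositional.Properties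
  using (∈-filter⁺; ∈-filter⁻; ∈-map⁺; ∈-map⁻; ∈-cartesianProductWith⁺)
open import Data.Nat.Base hiding (∣_-_∣)
import Data.Nat.ListAction as ℕ
open import Data.Nat.Properties
open import Data.Product.Base using (Σ; ∃; _×_; _,_; proj₁; proj₂)
open import Data.Sum.Base using (_⊎_; inj₁; inj₂)
open import Data.Vec.Base as Vec using (Vec; []; _∷_; lookup; last)
import Data.Vec.Properties as Vec
import Data.Bool.Properties as Bool
import Data.Vec.Relation.Unary.All as VecAll
import Data.Vec.Relation.Unary.AllPairs as AllPairs
open import Data.Vec.Relation.Unary.AllPairs.Core using ([]; _∷_)
open import Data.Vec.Relation.Unary.Linked using (Linked; linked?)
open import Data.Vec.Relation.Unary.Unique.Propositional using (Unique)
open import Function.Base using (_∘_)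
open import Function.Bundles using (_⇔_; Equivalence)
open import Relation.Binary.PropositionalEquality
  using (_≡_; _≢_; refl; sym; trans; cong; cong₂; subst; module ≡-Reasoning)
open import Relation.Nullary using (¬_; yes; no; does)
open import Relation.Nullary.Decidable using (_×-dec_; _→-dec_; ¬?)
open import Relation.Unary using (Pred; Decidable)

private
  variable
    n r k : ℕ

-- All vectors of length k with entries from xs.
vectors : ∀ {a} {A : Set a} → List A → (k : ℕ) → List (Vec A k)
vectors xs zero    = [] ∷ []
vectors xs (suc k) = cartesianProductWith _∷_ xs (vectors xs k)

subsets : (n : ℕ) → List (Subset n)
subsets = vectors (outside ∷ inside ∷ [])

∈-subsets : (A : Subset n) → A List.∈ subsets n
∈-subsets []      = here refl
∈-subsets (b ∷ A) = ∈-cartesianProductWith⁺ _∷_ (b∈ b) (∈-subsets A)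
  where
  b∈ : ∀ b → b List.∈ (outside ∷ inside ∷ [])
  b∈ outside = here refl
  b∈ inside  = there (here refl)

-- Matroids on the ground set Fin n, by independent sets.  Independence is taken to be
-- decidable, which is automatic classically and makes the rank function computable.
record Matroid (n : ℕ) : Set₁ where
  field
    Indep      : Pred (Subset n) 0ℓ
    indep?     : Decidable Indep
    indep-⊥    : Indep ⊥
    hereditary : ∀ {I J} → J ⊆ I → Indep I → Indep J
    augment    : ∀ {I J} → Indep I → Indep J → ∣ I ∣ < ∣ J ∣ →
                 ∃ λ e → e ∈ J × e ∉ I × Indep (I ∪ ⁅ e ⁆)

open Matroid

module _ (M : Matroid n) where

  independentSubsets : Subset n → List (Subset n)
  independentSubsets A = filter (λ I → indep? M I ×-dec (I ⊆? A)) (subsets n)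

  -- The list contains ⊥, so the default value 0 is harmless.
  rank : Subset n → ℕ
  rank A = max 0 (map ∣_∣ (independentSubsets A))

  IsBasis : Pred (Subset n) 0ℓ
  IsBasis B = Indep M B × (∀ {C} → Indep M C → B ⊆ C → B ≡ C)

  IsCircuit : Pred (Subset n) 0ℓ
  IsCircuit C = ¬ Indep M C × (∀ {D} → D ⊂ C → Indep M D)

  IsFlat : Pred (Subset n) 0ℓ
  IsFlat F = ∀ e → e ∉ F → rank F < rank (F ∪ ⁅ e ⁆)

  isFlat? : Decidable IsFlat
  isFlat? F = Fin.all? λ e → ¬? (e ∈? F) →-dec (rank F <? rank (F ∪ ⁅ e ⁆))

  IsHyperplane : Pred (Subset n) 0ℓ
  IsHyperplane H = IsFlat H × suc (rank H) ≡ rank ⊤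

-- M′ is the relaxation of M at the circuit-hyperplane X.
record IsRelaxation (M : Matroid n) (X : Subset n) (M′ : Matroid n) : Set where
  field
    circuit    : IsCircuit M X
    hyperplane : IsHyperplane M X
    bases      : ∀ B → IsBasis M′ B ⇔ (IsBasis M B ⊎ B ≡ X)

differences : Subset n → Vec (Subset n) k → List ℕ
differences Y []       = []
differences Y (X ∷ Xs) = ∣ X ─ Y ∣ ∷ differences X Xs

-- The composition (|X₀|, |X₁ − X₀|, …) of a chain X₀, X₁, ….
composition : Vec (Subset n) (suc k) → List ℕ
composition (X₀ ∷ Xs) = ∣ X₀ ∣ ∷ differences X₀ Xs

module _ (M : Matroid n) where

  IsFlag : Pred (Vec (Subset n) (suc k)) 0ℓ
  IsFlag Xs = Linked _⊂_ Xs
            × (∀ j → IsFlat M (lookup Xs j) × rank M (lookup Xs j) ≡ toℕ j)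
            × last Xs ≡ ⊤

  isFlag? : Decidable (IsFlag {k})
  isFlag? Xs = linked? _⊂?_ Xs
       ×-dec Fin.all? (λ j → isFlat? M (lookup Xs j) ×-dec (rank M (lookup Xs j) ≟ toℕ j))
       ×-dec Vec.≡-dec Bool._≟_ (last Xs) ⊤

  flags : List (Vec (Subset n) (suc (rank M ⊤)))
  flags = filter isFlag? (vectors (subsets n) (suc (rank M ⊤)))

  ν : List ℕ → ℕ
  ν a = length (filter (λ Xs → List.≡-dec _≟_ (composition Xs) a) flags)

-- (n,r)-compositions (a₀, …, a_r); only a₀ may vanish.
record IsComposition (n r : ℕ) (a : List ℕ) : Set where
  field
    length≡  : length a ≡ suc r
    positive : All (0 <_) (List.drop 1 a)
    sum≡     : ℕ.sum a ≡ n

0^_ 1^_ : ℕ → List ℕ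
0^ a = replicate a 0
1^ b = replicate b 1

infix 9 0^_ 1^_

ones : List ℕ → ℕ
ones w = length (filter (_≟ 1) w)

-- 0,1-sequences of length n with exactly r ones.
record IsWord (n r : ℕ) (w : List ℕ) : Set where
  constructor isWord
  field
    length≡ : length w ≡ n
    bits    : All (_≤ 1) w
    ones≡   : ones w ≡ r

Word : ℕ → ℕ → Set
Word n r = ∃ (IsWord n r)

-- A permutation π of Fin n is listed as the vector π(1), …, π(n).
Permutation : ℕ → Set
Permutation n = Σ (Vec (Fin n) n) Unique

unique? : Decidable (Unique {A = Fin n} {k})
unique? = AllPairs.allPairs? (λ i j → ¬? (i Fin.≟ j))

permutations : (n : ℕ) → List (Permutation n)
permutations n = All.toList (all-filter unique? (vectors (allFin n) n))

module _ (M : Matroid n) where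

  -- The rank increments when the entries of a vector are added to A one by one.
  increments : Subset n → Vec (Fin n) k → List ℕ
  increments A []       = []
  increments A (e ∷ es) = (rank M (A ∪ ⁅ e ⁆) ∸ rank M A) ∷ increments (A ∪ ⁅ e ⁆) es

  rankSequence : Permutation n → List ℕ
  rankSequence (π , _) = increments ⊥ π

∣p∪q∣≤∣p∣+∣q∣ : (p q : Subset n) → ∣ p ∪ q ∣ ≤ ∣ p ∣ + ∣ q ∣
∣p∪q∣≤∣p∣+∣q∣ []            []            = z≤n
∣p∪q∣≤∣p∣+∣q∣ (outside ∷ p) (outside ∷ q) = ∣p∪q∣≤∣p∣+∣q∣ p q
∣p∪q∣≤∣p∣+∣q∣ (outside ∷ p) (inside ∷ q)  =
  ≤-trans (s≤s (∣p∪q∣≤∣p∣+∣q∣ p q)) (≤-reflexive (sym (+-suc ∣ p ∣ ∣ q ∣)))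
∣p∪q∣≤∣p∣+∣q∣ (inside ∷ p)  (outside ∷ q) = s≤s (∣p∪q∣≤∣p∣+∣q∣ p q)
∣p∪q∣≤∣p∣+∣q∣ (inside ∷ p)  (inside ∷ q)  =
  s≤s (≤-trans (∣p∪q∣≤∣p∣+∣q∣ p q) (+-monoʳ-≤ ∣ p ∣ (n≤1+n ∣ q ∣)))

∣p∪⁅e⁆∣≤1+∣p∣ : (p : Subset n) (e : Fin n) → ∣ p ∪ ⁅ e ⁆ ∣ ≤ suc ∣ p ∣
∣p∪⁅e⁆∣≤1+∣p∣ p e =
  ≤-trans (∣p∪q∣≤∣p∣+∣q∣ p ⁅ e ⁆)
          (≤-reflexive (trans (cong (∣ p ∣ +_) (∣⁅x⁆∣≡1 e)) (+-comm ∣ p ∣ 1)))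

∣p∪⁅e⁆∣≡1+∣p∣ : (p : Subset n) (e : Fin n) → e ∉ p → ∣ p ∪ ⁅ e ⁆ ∣ ≡ suc ∣ p ∣
∣p∪⁅e⁆∣≡1+∣p∣ p e e∉p =
  ≤-antisym (∣p∪⁅e⁆∣≤1+∣p∣ p e)
    (p⊂q⇒∣p∣<∣q∣ (p⊆p∪q ⁅ e ⁆ , e , q⊆p∪q p ⁅ e ⁆ (x∈⁅x⁆ e) , e∉p))

module _ (M : Matroid n) where

  indep⇒≤rank : ∀ {I A} → Indep M I → I ⊆ A → ∣ I ∣ ≤ rank M A
  indep⇒≤rank {I} {A} ind I⊆A =
    All.lookup (xs≤max 0 (map ∣_∣ (independentSubsets M A)))
      (∈-map⁺ ∣_∣ (∈-filter⁺ (λ J → indep? M J ×-dec (J ⊆? A)) (∈-subsets I) (ind , I⊆A)))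

  rank-attained : ∀ A → ∃ λ I → Indep M I × I ⊆ A × ∣ I ∣ ≡ rank M A
  rank-attained A with argmax-sel (λ x → x) 0 (map ∣_∣ (independentSubsets M A))
  ... | inj₁ eq = ⊥ , indep-⊥ M , ⊥⊆ , trans (∣⊥∣≡0 n) (sym eq)
  ... | inj₂ m∈ with ∈-map⁻ ∣_∣ m∈
  ... | I , I∈ , eq with ∈-filter⁻ (λ J → indep? M J ×-dec (J ⊆? A)) {xs = subsets n} I∈
  ... | _ , ind , I⊆A = I , ind , I⊆A , sym eq

  rank-mono : ∀ {A B} → A ⊆ B → rank M A ≤ rank M B
  rank-mono {A} A⊆B with rank-attained A
  ... | I , ind , I⊆A , eq = subst (_≤ _) eq (indep⇒≤rank ind (A⊆B ∘ I⊆A))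

  rank-∪⁅⁆ : ∀ A e → rank M (A ∪ ⁅ e ⁆) ≤ suc (rank M A)
  rank-∪⁅⁆ A e with rank-attained (A ∪ ⁅ e ⁆)
  ... | I , ind , I⊆ , eq = begin
    rank M (A ∪ ⁅ e ⁆)   ≡⟨ eq ⟨
    ∣ I ∣                ≤⟨ p⊆q⇒∣p∣≤∣q∣ I⊆I-e∪e ⟩
    ∣ (I - e) ∪ ⁅ e ⁆ ∣  ≤⟨ ∣p∪⁅e⁆∣≤1+∣p∣ (I - e) e ⟩
    suc ∣ I - e ∣        ≤⟨ s≤s (indep⇒≤rank (hereditary M (p─q⊆p I ⁅ e ⁆) ind) I-e⊆A) ⟩
    suc (rank M A)       ∎
    where
    open ≤-Reasoning
    I⊆I-e∪e : I ⊆ (I - e) ∪ ⁅ e ⁆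
    I⊆I-e∪e {x} x∈I with x Fin.≟ e
    ... | yes refl = q⊆p∪q (I - e) ⁅ e ⁆ (x∈⁅x⁆ e)
    ... | no x≢e   = p⊆p∪q ⁅ e ⁆ (x∈p∧x≢y⇒x∈p-y x∈I x≢e)
    e∉I-e : ∀ {m} (p : Subset m) f → f ∉ p - f
    e∉I-e (s ∷ p) zero    ()
    e∉I-e (s ∷ p) (suc f) (Vec.there f∈) = e∉I-e p f f∈
    I-e⊆A : I - e ⊆ A
    I-e⊆A {x} x∈ with x∈p∪q⁻ A ⁅ e ⁆ (I⊆ (p─q⊆p I ⁅ e ⁆ x∈))
    ... | inj₁ x∈A = x∈A
    ... | inj₂ x∈e with x∈⁅y⁆⇒x≡y e x∈e
    ... | refl = ⊥-elim (e∉I-e I e x∈)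

  rank-⊥ : rank M ⊥ ≡ 0
  rank-⊥ with rank-attained ⊥
  ... | I , _ , I⊆⊥ , eq =
    n≤0⇒n≡0 (subst (_≤ 0) eq (≤-trans (p⊆q⇒∣p∣≤∣q∣ I⊆⊥) (≤-reflexive (∣⊥∣≡0 n))))

  accumulate : Subset n → Vec (Fin n) k → Subset n
  accumulate A []       = A
  accumulate A (e ∷ es) = accumulate (A ∪ ⁅ e ⁆) es

  length-increments : ∀ A (es : Vec (Fin n) k) → length (increments M A es) ≡ k
  length-increments A []       = refl
  length-increments A (e ∷ es) = cong suc (length-increments (A ∪ ⁅ e ⁆) es)

  bits-increments : ∀ A (es : Vec (Fin n) k) → All (_≤ 1) (increments M A es)
  bits-increments A []       = []
  bits-increments A (e ∷ es) =
    ≤-trans (∸-monoˡ-≤ (rank M A) (rank-∪⁅⁆ A e)) (≤-reflexive (m+n∸n≡m 1 (rank M A)))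
    ∷ bits-increments (A ∪ ⁅ e ⁆) es

  ones-∷ : ∀ {b} w → b ≤ 1 → ones (b ∷ w) ≡ b + ones w
  ones-∷ {zero}  w _         = refl
  ones-∷ {suc _} w (s≤s z≤n) = refl

  ones-increments : ∀ A (es : Vec (Fin n) k) →
                    rank M A + ones (increments M A es) ≡ rank M (accumulate A es)
  ones-increments A []       = +-identityʳ _
  ones-increments A (e ∷ es) with bits-increments A (e ∷ es)
  ... | b≤1 ∷ _ = begin
    rank M A + ones (b ∷ w)              ≡⟨ cong (rank M A +_) (ones-∷ w b≤1) ⟩
    rank M A + (b + ones w)              ≡⟨ +-assoc (rank M A) b (ones w) ⟨
    rank M A + b + ones w                ≡⟨ cong (_+ ones w) (m+[n∸m]≡n (rank-mono (p⊆p∪q ⁅ e ⁆))) ⟩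
    rank M (A ∪ ⁅ e ⁆) + ones w          ≡⟨ ones-increments (A ∪ ⁅ e ⁆) es ⟩
    rank M (accumulate (A ∪ ⁅ e ⁆) es)   ∎
    where
    open ≡-Reasoning
    b = rank M (A ∪ ⁅ e ⁆) ∸ rank M A
    w = increments M (A ∪ ⁅ e ⁆) es

  ∣accumulate∣ : ∀ A (es : Vec (Fin n) k) → VecAll.All (_∉ A) es → Unique es →
                 ∣ accumulate A es ∣ ≡ ∣ A ∣ + k
  ∣accumulate∣ A []       _            _           = sym (+-identityʳ _)
  ∣accumulate∣ {suc k} A (e ∷ es) (e∉A VecAll.∷ ∉A) (e≢ ∷ u) = trans
    (∣accumulate∣ (A ∪ ⁅ e ⁆) es (VecAll.map fresh (VecAll.zip (∉A , e≢))) u)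
    (trans (cong (_+ k) (∣p∪⁅e⁆∣≡1+∣p∣ A e e∉A)) (sym (+-suc ∣ A ∣ k)))
    where
    fresh : ∀ {x} → x ∉ A × e ≢ x → x ∉ A ∪ ⁅ e ⁆
    fresh (x∉A , e≢x) x∈ with x∈p∪q⁻ A ⁅ e ⁆ x∈
    ... | inj₁ x∈A = x∉A x∈A
    ... | inj₂ x∈e = e≢x (sym (x∈⁅y⁆⇒x≡y e x∈e))

  rankSequence-isWord : rank M ⊤ ≡ r → ∀ π → IsWord n r (rankSequence M π)
  rankSequence-isWord rk (π , u) = isWord (length-increments ⊥ π) (bits-increments ⊥ π)
    (trans (trans (trans (cong (_+ ones (increments M ⊥ π)) (sym rank-⊥)) (ones-increments ⊥ π))
                  (cong (rank M) accumulate≡⊤)) rk)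
    where
    accumulate≡⊤ : accumulate ⊥ π ≡ ⊤
    accumulate≡⊤ = ∣p∣≡n⇒p≡⊤
      (trans (∣accumulate∣ ⊥ π (VecAll.universal (λ _ → ∉⊥) π) u) (cong (_+ n) (∣⊥∣≡0 n)))

module _ {M M′ : Matroid n} {X : Subset n} (R : IsRelaxation M X M′) (rk : rank M ⊤ ≡ r) where

  open IsRelaxation R

  0<r : 0 < r
  0<r = subst (0 <_) (trans (proj₂ hyperplane) rk) z<s

  r<n : r < n
  r<n with rank-attained M ⊤
  ... | I , ind , _ , eq = ≤∧≢⇒< (subst (_≤ n) ∣I∣≡r (∣p∣≤n I)) λ r≡n →
    proj₁ circuit (hereditary M ⊆⊤ (subst (Indep M) (∣p∣≡n⇒p≡⊤ (trans ∣I∣≡r r≡n)) ind))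
    where ∣I∣≡r = trans eq rk

  relaxation-rank : rank M′ ⊤ ≡ r
  relaxation-rank with rank-attained M ⊤ | rank-attained M′ ⊤
  ... | B , indB , _ , ∣B∣≡ | I , indI , _ , ∣I∣≡ =
    trans (≤-antisym (subst (_≤ ∣ B ∣) ∣I∣≡ (≮⇒≥ ∣B∣≮∣I∣)) (indep⇒≤rank M′ indB′ ⊆⊤))
          (trans ∣B∣≡ rk)
    where
    maximal : ∀ {C} → Indep M C → B ⊆ C → B ≡ C
    maximal {C} indC B⊆C = ⊆-antisym B⊆C C⊆B
      where
      C⊆B : C ⊆ B
      C⊆B {x} x∈C with x ∈? B
      ... | yes x∈B = x∈B
      ... | no x∉B  = ⊥-elim (<⇒≱ (p⊂q⇒∣p∣<∣q∣ (B⊆C , x , x∈C , x∉B))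
                        (subst (∣ C ∣ ≤_) (sym ∣B∣≡) (indep⇒≤rank M indC ⊆⊤)))
    basis′ : IsBasis M′ B
    basis′ = Equivalence.from (bases B) (inj₁ (indB , maximal))
    indB′ = proj₁ basis′
    ∣B∣≮∣I∣ : ∣ B ∣ ≮ ∣ I ∣
    ∣B∣≮∣I∣ B<I with augment M′ indB′ indI B<I
    ... | e , _ , e∉B , ind =
      e∉B (subst (e ∈_) (sym (proj₂ basis′ ind (p⊆p∪q ⁅ e ⁆))) (q⊆p∪q B ⁅ e ⁆ (x∈⁅x⁆ e)))

ones-++ : ∀ v w → ones (v ++ w) ≡ ones v + ones w
ones-++ v w = trans (cong length (List.filter-++ (_≟ 1) v w)) (List.length-++ (filter (_≟ 1) v))

ones-0^ : ∀ a → ones (0^ a) ≡ 0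
ones-0^ zero    = refl
ones-0^ (suc a) = ones-0^ a

ones-1^ : ∀ b → ones (1^ b) ≡ b
ones-1^ zero    = refl
ones-1^ (suc b) = cong suc (ones-1^ b)

isWord-++ : ∀ {m n r s v w} → IsWord m r v → IsWord n s w → IsWord (m + n) (r + s) (v ++ w)
isWord-++ {v = v} {w} (isWord l b o) (isWord l′ b′ o′) = isWord
  (trans (List.length-++ v) (cong₂ _+_ l l′)) (All.++⁺ b b′) (trans (ones-++ v w) (cong₂ _+_ o o′))

0^-isWord : ∀ a → IsWord a 0 (0^ a)
0^-isWord a = isWord (List.length-replicate a) (All.replicate⁺ a z≤n) (ones-0^ a)

1^-isWord : ∀ b → IsWord b b (1^ b)
1^-isWord b = isWord (List.length-replicate b) (All.replicate⁺ b ≤-refl) (ones-1^ b)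

resize : ∀ {m n r s w} → m ≡ n → r ≡ s → IsWord m r w → IsWord n s w
resize refl refl p = p

1^r0^[n-r]-isWord : r < n → IsWord n r (1^ r ++ 0^ (n ∸ r))
1^r0^[n-r]-isWord {r} {n} r<n =
  resize (m+[n∸m]≡n (<⇒≤ r<n)) (+-identityʳ r) (isWord-++ (1^-isWord r) (0^-isWord (n ∸ r)))

1^[r-1]010^[n-r-1]-isWord : 0 < r → r < n →
                            IsWord n r (1^ (r ∸ 1) ++ 0 ∷ 1 ∷ 0^ (n ∸ r ∸ 1))
1^[r-1]010^[n-r-1]-isWord {suc q} {suc m} _ (s≤s q<m) =
  resize eq (+-comm q 1)
    (isWord-++ (1^-isWord q) (isWord-++ 01-isWord (0^-isWord (m ∸ q ∸ 1))))
  where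
  01-isWord : IsWord 2 1 (0 ∷ 1 ∷ [])
  01-isWord = isWord refl (z≤n ∷ ≤-refl ∷ []) refl
  eq : q + (2 + (m ∸ q ∸ 1)) ≡ suc m
  eq = trans (+-suc q _) (cong suc
         (trans (cong (q +_) (m+[n∸m]≡n {1} (m<n⇒0<n∸m q<m))) (m+[n∸m]≡n (<⇒≤ q<m))))

commutativeRing : ∀ {c ℓ₁ ℓ₂} → HeytingField c ℓ₁ ℓ₂ → CommutativeRing c ℓ₁
commutativeRing K = HeytingCommutativeRing.commutativeRing (HeytingField.heytingCommutativeRing K)

module _ {c ℓ₁ ℓ₂} (K : HeytingField c ℓ₁ ℓ₂) where

  private module F = CommutativeRing (commutativeRing K)

  fromℕ : ℕ → F.Carrier
  fromℕ m = RawMonoid._×_ F.+-rawMonoid m F.1#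

  -- This also rules out the zero ring, which HeytingField admits.
  CharacteristicZero : Set ℓ₁
  CharacteristicZero = ∀ m → ¬ (fromℕ (suc m) F.≈ F.0#)

  -- 𝒢(n,r) as functions on its finite set of basis symbols: v s is the coefficient of [ s ].
  𝒢Space : ℕ → ℕ → Module (commutativeRing K) c ℓ₁
  𝒢Space n r = record
    { Carrierᴹ = Carrierᴹ
    ; _≈ᴹ_     = _≈ᴹ_
    ; _+ᴹ_     = _∙_
    ; _*ₗ_     = λ x v s → x F.* v s
    ; _*ᵣ_     = λ v x s → x F.* v s
    ; 0ᴹ       = ε
    ; -ᴹ_      = _⁻¹
    ; isModule = IsModuleFromLeft.isModule {commutativeRing = commutativeRing K} record
      { isLeftModule = record
        { isLeftSemimodule = record
          { +ᴹ-isCommutativeMonoid = isCommutativeMonoid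
          ; isPreleftSemimodule = record
            { *ₗ-cong      = λ x≈y u≈v s → F.*-cong x≈y (u≈v s)
            ; *ₗ-zeroˡ     = λ v s → F.zeroˡ (v s)
            ; *ₗ-distribʳ  = λ v x y s → F.distribʳ (v s) x y
            ; *ₗ-identityˡ = λ v s → F.*-identityˡ (v s)
            ; *ₗ-assoc     = λ x y v s → F.*-assoc x y (v s)
            ; *ₗ-zeroʳ     = λ x s → F.zeroʳ x
            ; *ₗ-distribˡ  = λ x u v s → F.distribˡ x (u s) (v s)
            }
          }
        ; -ᴹ‿cong    = ⁻¹-cong
        ; -ᴹ‿inverse = inverse
        }
      }
    }
    where
    open AbelianGroup (Pointwise.abelianGroup (Word n r) F.+-abelianGroup)
      renaming (Carrier to Carrierᴹ; _≈_ to _≈ᴹ_)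

  module 𝒢 {n r : ℕ} where

    open Module (𝒢Space n r) public
      using (Carrierᴹ; _≈ᴹ_; _+ᴹ_; 0ᴹ; -ᴹ_; _*ₗ_)

    infixl 6 _-ᴹ_
    _-ᴹ_ : Carrierᴹ → Carrierᴹ → Carrierᴹ
    u -ᴹ v = u +ᴹ (-ᴹ v)

    [_] : Word n r → Carrierᴹ
    [ s ] t = if does (List.≡-dec _≟_ (proj₁ s) (proj₁ t)) then F.1# else F.0#

    𝒢-invariant : (M : Matroid n) → rank M ⊤ ≡ r → Carrierᴹ
    𝒢-invariant M rk = foldr _+ᴹ_ 0ᴹ
      (map (λ π → [ rankSequence M π , rankSequence-isWord M rk π ]) (permutations n))

module Submission where

-- Write r′ for the rank function of M′.  It agrees with that of M except that r′(X) = r(X) + 1 = r.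
-- Hence the rank sequence of a permutation changes only if its first r entries form X; then it is
-- 1^(r-1) 0 1 0^(n-r-1) in M and 1^r 0^(n-r) in M′, and there are r! (n-r)! such permutations.
--
-- In passing from M to M′ the flat X is lost and the sets X − e become flats.  Every subset of X
-- with at most r − 2 elements is a flat of M and of M′, so the flags lost are the chains
-- ∅ ⊂ {x₁} ⊂ … ⊂ {x₁, …, x_(r-2)} ⊂ X ⊂ E and the flags gained are the chains
-- ∅ ⊂ {x₁} ⊂ … ⊂ {x₁, …, x_(r-1)} ⊂ E with all xᵢ in X; their numbers are r!/2 and r!.

open import Defs
open import Algebra.Apartness.Bundles using (HeytingField)
open import Algebra.Bundles using (AbelianGroup; CommutativeRing)
import Algebra.Definitions.RawMonoid as RawMonoid
open import Algebra.Module.Bundles using (Module)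
import Algebra.Properties.AbelianGroup as AbelianGroupProperties
import Algebra.Properties.CommutativeSemigroup as CommutativeSemigroupProperties
open import Data.Bool.Base using (if_then_else_)
import Data.Bool.Properties as Bool
open import Data.Empty using (⊥-elim)
open import Data.Fin.Base using (Fin; zero; suc; toℕ)
import Data.Fin.Properties as Fin
open import Data.Fin.Subset
open import Data.Fin.Subset.Properties
import Data.Integer.Base as ℤ
import Data.Integer.Properties as ℤ
open import Data.List.Base as List
  using (List; []; _∷_; _++_; length; map; foldr; filter; replicate; cartesianProductWith; allFin)
import Data.List.Properties as List
open import Data.List.Relation.Unary.All as All using (All; []; _∷_)
open import Data.List.Relation.Unary.All.Properties using (all-filter)
open import Data.Nat.Base hiding (∣_-_∣)
open import Data.Nat.DivMod using (m*n/n≡m)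
open import Data.Nat.Properties
open import Data.Product.Base using (∃; _×_; _,_; proj₁; proj₂)
open import Data.Sum.Base using (_⊎_; inj₁; inj₂; [_,_]′)
import Data.Unit.Base as Unit
open import Data.Vec.Base as Vec using (Vec; []; _∷_; lookup; last; here; there)
import Data.Vec.Properties as Vec
import Data.Vec.Relation.Unary.All as VecAll
open import Data.Vec.Relation.Unary.AllPairs.Core using ([]; _∷_)
open import Data.Vec.Relation.Unary.Linked using (Linked; []; [-]; _∷_)
open import Data.Vec.Relation.Unary.Unique.Propositional using (Unique)
open import Function.Base using (_∘_; id)
open import Function.Bundles using (_⇔_; mk⇔; Equivalence)
open import Relation.Binary.Definitions using (DecidableEquality)
open import Relation.Binary.PropositionalEquality
  using (_≡_; _≢_; refl; sym; trans; cong; cong₂; subst; subst₂; module ≡-Reasoning)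
import Relation.Binary.Reasoning.Setoid as SetoidReasoning
open import Relation.Nullary using (¬_; Dec; yes; no; does; contradiction)
open import Relation.Nullary.Decidable using (_×-dec_; _⊎-dec_; ¬?)
open import Relation.Unary using (Pred; Decidable)

open Matroid

-- Counting

-- A relaxation is specified by its bases only, so ranks are compared through independent sets: each
-- extends to a basis, hence those of `M′` are those of `M` and `X`. The new one raises no rank but
-- that of `X`, because a set properly containing the hyperplane `X` has rank `r` in `M` already.
-- For flats the decisive fact is that a proper subset of `X` stays independent in `M` when an
-- element outside `X` is added.
--
-- Permutations and flags are counted on explicit lists of vectors, one entry at a time. This calls
-- for conditions in which the admissible next entries depend only on the set reached so far, and
-- their number only on its size; `Fresh`, `Hit` and `Climb` have this form.
--
-- The factor 1/2 arises because the last two elements of `X` enter a lost flag together. For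
-- `r = 1` the set `X` is a single loop and the lost flag has composition `(1, n − 1)`; hence the
-- condition `2 ≤ r` on the second formula and on the list of exceptional compositions.

count : ∀ {a p} {A : Set a} {P : Pred A p} → Decidable P → List A → ℕ
count P? xs = length (filter P? xs)

module _ {a} {A : Set a} where

  module _ {p q} {P : Pred A p} {Q : Pred A q} (P? : Decidable P) (Q? : Decidable Q) where

    count-cong : (∀ {x} → P x → Q x) → (∀ {x} → Q x → P x) → ∀ xs → count P? xs ≡ count Q? xs
    count-cong P⇒Q Q⇒P xs = cong length (List.filter-≐ P? Q? (P⇒Q , Q⇒P) xs)

    count-filter : ∀ xs → count P? (filter Q? xs) ≡ count (λ x → Q? x ×-dec P? x) xs
    count-filter []       = refl
    count-filter (x ∷ xs) with Q? x
    ... | no _ = count-filter xs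
    ... | yes _ with P? x
    ...   | yes _ = cong suc (count-filter xs)
    ...   | no _  = count-filter xs

    count-split : ∀ xs → count P? xs ≡
      count (λ x → P? x ×-dec Q? x) xs + count (λ x → P? x ×-dec ¬? (Q? x)) xs
    count-split []       = refl
    count-split (x ∷ xs) with P? x | Q? x
    ... | no _  | _     = count-split xs
    ... | yes _ | yes _ = cong suc (count-split xs)
    ... | yes _ | no _  = trans (cong suc (count-split xs)) (sym (+-suc _ _))

  module _ {p} {P : Pred A p} (P? : Decidable P) where

    count-none : (∀ {x} → ¬ P x) → ∀ xs → count P? xs ≡ 0
    count-none ¬P xs = cong length (List.filter-none P? (All.universal (λ _ → ¬P) xs))

    count-++ : ∀ xs ys → count P? (xs ++ ys) ≡ count P? xs + count P? ys
    count-++ xs ys = trans (cong length (List.filter-++ P? xs ys)) (List.length-++ (filter P? xs))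

    count-map : ∀ {b} {B : Set b} (f : B → A) xs → count P? (map f xs) ≡ count (P? ∘ f) xs
    count-map f []       = refl
    count-map f (x ∷ xs) with P? (f x)
    ... | yes _ = cong suc (count-map f xs)
    ... | no _  = count-map f xs

module _ {a} {A : Set a} where

  module _ {p q} {P : Pred A p} {k} {Q : Pred (Vec A (suc k)) q} (P? : Decidable P) (Q? : Decidable Q)
           (Q⇒P : ∀ {x v} → Q (x ∷ v) → P x) where

    -- Product rule: every admissible head has the same number `c` of completions, and by `Q⇒P` the
    -- other heads contribute nothing. Its iteration produces all the factorials below.
    count-vectors : ∀ xs {c} → (∀ {x} → P x → count (λ v → Q? (x ∷ v)) (vectors xs k) ≡ c) →
                    count Q? (vectors xs (suc k)) ≡ count P? xs * c
    count-vectors xs {c} hyp = go xs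
      where
      vs = vectors xs k
      go : ∀ ys → count Q? (cartesianProductWith _∷_ ys vs) ≡ count P? ys * c
      go []       = refl
      go (y ∷ ys) with P? y
      ... | yes Py = trans (count-++ Q? (map (y ∷_) vs) _)
        (cong₂ _+_ (trans (count-map Q? (y ∷_) vs) (hyp Py)) (go ys))
      ... | no ¬Py = trans (count-++ Q? (map (y ∷_) vs) _)
        (cong₂ _+_ (trans (count-map Q? (y ∷_) vs) (count-none (λ v → Q? (y ∷ v)) (¬Py ∘ Q⇒P) vs)) (go ys))

  module _ (_≟ᴬ_ : DecidableEquality A) (xs : List A) (once : ∀ x → count (_≟ᴬ x) xs ≡ 1) where

    count-vectors-≡ : ∀ {k} (v : Vec A k) → count (λ u → Vec.≡-dec _≟ᴬ_ u v) (vectors xs k) ≡ 1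
    count-vectors-≡ []      = refl
    count-vectors-≡ {suc k} (x ∷ v) = trans
      (count-vectors (_≟ᴬ x) (λ u → Vec.≡-dec _≟ᴬ_ u (x ∷ v)) Vec.∷-injectiveˡ xs
        λ { refl → trans (count-cong (λ u → Vec.≡-dec _≟ᴬ_ (x ∷ u) (x ∷ v)) (λ u → Vec.≡-dec _≟ᴬ_ u v)
                            Vec.∷-injectiveʳ (cong (x ∷_)) (vectors xs k))
                          (count-vectors-≡ v) })
      (trans (*-identityʳ _) (once x))

_≟ˢ_ : ∀ {n} → DecidableEquality (Subset n)
_≟ˢ_ = Vec.≡-dec Bool._≟_

count-subsets-≡ : ∀ {n} (A : Subset n) → count (_≟ˢ A) (subsets n) ≡ 1
count-subsets-≡ = count-vectors-≡ Bool._≟_ _ λ { inside → refl ; outside → refl }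

count-allFin-∈ : ∀ {n} (p : Subset n) → count (_∈? p) (allFin n) ≡ ∣ p ∣
count-allFin-∈ []      = refl
count-allFin-∈ {suc n} (s ∷ p) = trans (cong (count (_∈? (s ∷ p)) ∘ (zero ∷_)) (sym (List.map-tabulate id suc)))
  (go s)
  where
  rest : ∀ s → count (_∈? (s ∷ p)) (map suc (allFin n)) ≡ ∣ p ∣
  rest s = trans (count-map (_∈? (s ∷ p)) suc (allFin n))
    (trans (count-cong (λ x → suc x ∈? (s ∷ p)) (_∈? p) drop-there there (allFin n)) (count-allFin-∈ p))
  go : ∀ s → count (_∈? (s ∷ p)) (zero ∷ map suc (allFin n)) ≡ ∣ s ∷ p ∣
  go inside  = cong suc (rest inside)
  go outside = rest outside

∣p─q∣≡∣p∣∸∣q∣ : ∀ {n} (p q : Subset n) → q ⊆ p → ∣ p ─ q ∣ ≡ ∣ p ∣ ∸ ∣ q ∣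
∣p─q∣≡∣p∣∸∣q∣ p q q⊆p = sym (trans (cong (_∸ ∣ q ∣) (sym (go p q q⊆p))) (m+n∸n≡m ∣ p ─ q ∣ ∣ q ∣))
  where
  go : ∀ {n} (p q : Subset n) → q ⊆ p → ∣ p ─ q ∣ + ∣ q ∣ ≡ ∣ p ∣
  go []            []            _   = refl
  go (outside ∷ p) (outside ∷ q) q⊆p = go p q (drop-∷-⊆ q⊆p)
  go (outside ∷ p) (inside ∷ q)  q⊆p with () ← q⊆p here
  go (inside ∷ p)  (outside ∷ q) q⊆p = cong suc (go p q (drop-∷-⊆ q⊆p))
  go (inside ∷ p)  (inside ∷ q)  q⊆p = trans (+-suc _ _) (cong suc (go p q (drop-∷-⊆ q⊆p)))

-- `B` arises from `A` by adding one element of `X`. Inclusion and size express this without naming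
-- the element, so the condition is decidable set by set.
Step : ∀ {n} → Subset n → Subset n → Subset n → Set
Step X A B = A ⊆ B × B ⊆ X × ∣ B ∣ ≡ suc ∣ A ∣

step? : ∀ {n} (X A : Subset n) → Decidable (Step X A)
step? X A B = A ⊆? B ×-dec B ⊆? X ×-dec ∣ B ∣ ≟ suc ∣ A ∣

⊆∧≥⇒≡ : ∀ {n} {A B : Subset n} → A ⊆ B → ∣ B ∣ ≤ ∣ A ∣ → A ≡ B
⊆∧≥⇒≡ {A = A} {B} A⊆B ∣B∣≤∣A∣ = ⊆-antisym A⊆B B⊆A
  where
  B⊆A : B ⊆ A
  B⊆A {x} x∈B with x ∈? A
  ... | yes x∈A = x∈A
  ... | no x∉A  = contradiction ∣B∣≤∣A∣ (<⇒≱ (p⊂q⇒∣p∣<∣q∣ (A⊆B , x , x∈B , x∉A)))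

count-subsets-∷ : ∀ {n p} {P : Pred (Subset (suc n)) p} (P? : Decidable P) →
  count P? (subsets (suc n)) ≡
  count (P? ∘ (outside ∷_)) (subsets n) + count (P? ∘ (inside ∷_)) (subsets n)
count-subsets-∷ {n} P? = trans (count-++ P? (map (outside ∷_) ss) _)
  (cong₂ _+_ (count-map P? (outside ∷_) ss)
    (trans (cong (count P?) (List.++-identityʳ (map (inside ∷_) ss))) (count-map P? (inside ∷_) ss)))
  where ss = subsets n

-- Induction over the positions. A position in `X` but not in `A` contributes one set that gains
-- this element and agrees with `A` afterwards; at any other position the bit of `B` is forced.
count-step : ∀ {n} (X A : Subset n) → A ⊆ X → count (step? X A) (subsets n) ≡ ∣ X ∣ ∸ ∣ A ∣
count-step {n} X A A⊆X = trans (go X A A⊆X) (∣p─q∣≡∣p∣∸∣q∣ X A A⊆X)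
  where
  go : ∀ {n} (X A : Subset n) → A ⊆ X → count (step? X A) (subsets n) ≡ ∣ X ─ A ∣
  go []      []      _   = refl
  go {suc n} (x ∷ X) (a ∷ A) A⊆X = trans (count-subsets-∷ (step? (x ∷ X) (a ∷ A))) (bits x a A⊆X)
    where
    ss = subsets n
    ih = go X A (drop-∷-⊆ A⊆X)
    out in′ : ∀ x a → ℕ
    out x a = count (step? (x ∷ X) (a ∷ A) ∘ (outside ∷_)) ss
    in′ x a = count (step? (x ∷ X) (a ∷ A) ∘ (inside ∷_)) ss
    same : ∀ x → out x outside ≡ ∣ X ─ A ∣
    same x = trans (count-cong (step? (x ∷ X) (outside ∷ A) ∘ (outside ∷_)) (step? X A)
      (λ (p , q , e) → drop-∷-⊆ p , drop-∷-⊆ q , e) (λ (p , q , e) → out⊆ p , out⊆ q , e) ss) ih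
    bits : ∀ x a → a ∷ A ⊆ x ∷ X → out x a + in′ x a ≡ ∣ (x ∷ X) ─ (a ∷ A) ∣
    bits outside inside  A⊆X with () ← A⊆X here
    bits outside outside _ = trans (cong₂ _+_ (same outside)
      (count-none (step? (outside ∷ X) (outside ∷ A) ∘ (inside ∷_)) (λ (_ , q , _) → case-∈ (q here)) ss))
      (+-identityʳ _)
      where
      case-∈ : ¬ (zero ∈ outside ∷ X)
      case-∈ ()
    bits inside  outside _ = trans (cong₂ _+_ (same inside)
      (trans (count-cong (step? (inside ∷ X) (outside ∷ A) ∘ (inside ∷_)) (_≟ˢ A)
         (λ (p , q , e) → sym (⊆∧≥⇒≡ (drop-∷-⊆ p) (≤-reflexive (suc-injective e))))
         (λ { refl → out⊆ id , in⊆in (drop-∷-⊆ A⊆X) , refl }) ss)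
       (count-subsets-≡ A)))
      (+-comm _ 1)
    bits inside  inside  _ = cong₂ _+_
      (count-none (step? (inside ∷ X) (inside ∷ A) ∘ (outside ∷_)) (λ (p , _) → case-∈ (p here)) ss)
      (trans (count-cong (step? (inside ∷ X) (inside ∷ A) ∘ (inside ∷_)) (step? X A)
        (λ (p , q , e) → drop-∷-⊆ p , drop-∷-⊆ q , suc-injective e)
        (λ (p , q , e) → in⊆in p , in⊆in q , cong suc e) ss) ih)
      where
      case-∈ : ∀ {B} → ¬ (zero ∈ outside ∷ B)
      case-∈ ()

-- Flats and ranks of a relaxation

∪⁅⁆-⊆ : ∀ {n} {A B : Subset n} {e} → A ⊆ B → e ∈ B → A ∪ ⁅ e ⁆ ⊆ B
∪⁅⁆-⊆ {A = A} {e = e} A⊆B e∈B x∈ with x∈p∪q⁻ A ⁅ e ⁆ x∈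
... | inj₁ x∈A = A⊆B x∈A
... | inj₂ x∈e with refl ← x∈⁅y⁆⇒x≡y e x∈e = e∈B

e∈∪⁅e⁆ : ∀ {n} (A : Subset n) e → e ∈ A ∪ ⁅ e ⁆
e∈∪⁅e⁆ A e = q⊆p∪q A ⁅ e ⁆ (x∈⁅x⁆ e)

A⊆A∪⁅e⁆ : ∀ {n} (A : Subset n) e → A ⊆ A ∪ ⁅ e ⁆
A⊆A∪⁅e⁆ A e = p⊆p∪q ⁅ e ⁆

⊆∧≢⇒⊂ : ∀ {n} {A B : Subset n} → A ⊆ B → A ≢ B → A ⊂ B
⊆∧≢⇒⊂ {A = A} {B} A⊆B A≢B with A ⊂? B
... | yes A⊂B = A⊂B
... | no A⊄B  = contradiction (⊆-antisym A⊆B B⊆A) A≢B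
  where
  B⊆A : B ⊆ A
  B⊆A {x} x∈B with x ∈? A
  ... | yes x∈A = x∈A
  ... | no x∉A  = ⊥-elim (A⊄B (A⊆B , x , x∈B , x∉A))

∣p∣≡0⇒p≡⊥ : ∀ {n} {p : Subset n} → ∣ p ∣ ≡ 0 → p ≡ ⊥
∣p∣≡0⇒p≡⊥ ∣p∣≡0 = sym (⊆∧≥⇒≡ ⊥⊆ (subst (_≤ _) (sym ∣p∣≡0) z≤n))

x∈p─q⇒x∉q : ∀ {n} {x : Fin n} (p q : Subset n) → x ∈ p ─ q → x ∉ q
x∈p─q⇒x∉q (s ∷ p) (outside ∷ q) (Vec.there x∈) (Vec.there x∈q) = x∈p─q⇒x∉q p q x∈ x∈q
x∈p─q⇒x∉q (s ∷ p) (inside ∷ q)  (Vec.there x∈) (Vec.there x∈q) = x∈p─q⇒x∉q p q x∈ x∈q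

suc∣p-e∣≡∣p∣ : ∀ {n} {p : Subset n} {e} → e ∈ p → suc ∣ p - e ∣ ≡ ∣ p ∣
suc∣p-e∣≡∣p∣ {p = p} {e} e∈p =
  trans (sym (∣p∪⁅e⁆∣≡1+∣p∣ (p - e) e λ e∈ → x∈p─q⇒x∉q p ⁅ e ⁆ e∈ (x∈⁅x⁆ e)))
        (cong ∣_∣ (⊆-antisym (∪⁅⁆-⊆ (p─q⊆p p ⁅ e ⁆) e∈p) p⊆))
  where
  p⊆ : p ⊆ (p - e) ∪ ⁅ e ⁆
  p⊆ {x} x∈p with x Fin.≟ e
  ... | yes refl = e∈∪⁅e⁆ (p - e) e
  ... | no x≢e   = A⊆A∪⁅e⁆ (p - e) e (x∈p∧x≢y⇒x∈p-y x∈p x≢e)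

module _ {n} (M : Matroid n) where

  rank≤∣∣ : ∀ A → rank M A ≤ ∣ A ∣
  rank≤∣∣ A with I , _ , I⊆A , eq ← rank-attained M A = subst (_≤ ∣ A ∣) eq (p⊆q⇒∣p∣≤∣q∣ I⊆A)

  rank-indep : ∀ {I} → Indep M I → rank M I ≡ ∣ I ∣
  rank-indep {I} ind = ≤-antisym (rank≤∣∣ I) (indep⇒≤rank M ind id)

  ∣∣≤rank⇒indep : ∀ {A} → ∣ A ∣ ≤ rank M A → Indep M A
  ∣∣≤rank⇒indep {A} le with I , ind , I⊆A , eq ← rank-attained M A =
    subst (Indep M) (⊆∧≥⇒≡ I⊆A (subst (∣ A ∣ ≤_) (sym eq) le)) ind

  indep-∪-<-rank : ∀ {A e} → Indep M (A ∪ ⁅ e ⁆) → e ∉ A → rank M A < rank M (A ∪ ⁅ e ⁆)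
  indep-∪-<-rank {A} {e} ind e∉A = subst (λ m → suc (rank M A) ≤ m)
    (sym (trans (rank-indep ind) (∣p∪⁅e⁆∣≡1+∣p∣ A e e∉A))) (s≤s (rank≤∣∣ A))

  ∣∣≡rank⇒basis : ∀ {B} → Indep M B → ∣ B ∣ ≡ rank M ⊤ → IsBasis M B
  ∣∣≡rank⇒basis ind eq = ind , λ {C} indC B⊆C →
    ⊆∧≥⇒≡ B⊆C (subst (∣ C ∣ ≤_) (sym eq) (indep⇒≤rank M indC ⊆⊤))

  -- Translates hypotheses on bases into statements about independent sets. The first argument of
  -- `go` is the number of elements still missing; each one is taken from a maximum independent set.
  extend-to-basis : ∀ {I} → Indep M I → ∃ λ B → IsBasis M B × I ⊆ B
  extend-to-basis {I} ind = go (rank M ⊤ ∸ ∣ I ∣) ind (m+[n∸m]≡n (indep⇒≤rank M ind ⊆⊤))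
    where
    go : ∀ d {I} → Indep M I → ∣ I ∣ + d ≡ rank M ⊤ → ∃ λ B → IsBasis M B × I ⊆ B
    go zero {I} ind eq = I , ∣∣≡rank⇒basis ind (trans (sym (+-identityʳ _)) eq) , id
    go (suc d) {I} ind eq with J , indJ , _ , ∣J∣≡ ← rank-attained M ⊤
      with e , _ , e∉I , ind′ ← augment M ind indJ
             (subst (∣ I ∣ <_) (trans eq (sym ∣J∣≡)) (m<m+n ∣ I ∣ z<s))
      with B , basis , I∪e⊆B ← go d ind′
             (trans (cong (_+ d) (∣p∪⁅e⁆∣≡1+∣p∣ I e e∉I)) (trans (sym (+-suc ∣ I ∣ d)) eq)) =
      B , basis , I∪e⊆B ∘ A⊆A∪⁅e⁆ I e

module Relax {n r} {M M′ : Matroid n} {X : Subset n} (R : IsRelaxation M X M′) (rk : rank M ⊤ ≡ r) where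

  open IsRelaxation R public

  rk′ : rank M′ ⊤ ≡ r
  rk′ = relaxation-rank R rk

  ⊂X⇒indep : ∀ {A} → A ⊂ X → Indep M A
  ⊂X⇒indep = proj₂ circuit

  suc-rank-X : suc (rank M X) ≡ r
  suc-rank-X = trans (proj₂ hyperplane) rk

  -- A circuit has one element more than its rank: it is dependent, but loses its dependence with
  -- any one element. The rank is `r − 1` since `X` is a hyperplane.
  ∣X∣≡r : ∣ X ∣ ≡ r
  ∣X∣≡r = trans (≤-antisym ∣X∣≤ (≰⇒> (proj₁ circuit ∘ ∣∣≤rank⇒indep M))) suc-rank-X
    where
    ∣X∣≤ : ∣ X ∣ ≤ suc (rank M X)
    ∣X∣≤ with nonempty? X
    ... | no empty      = subst (_≤ suc (rank M X)) (sym (trans (cong ∣_∣ (Empty-unique empty)) (∣⊥∣≡0 n))) z≤n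
    ... | yes (e , e∈X) = subst (_≤ suc (rank M X)) (suc∣p-e∣≡∣p∣ e∈X)
      (s≤s (indep⇒≤rank M (⊂X⇒indep (x∈p⇒p-x⊂p e∈X)) (p─q⊆p X ⁅ e ⁆)))

  indep′-X : Indep M′ X
  indep′-X = proj₁ (Equivalence.from (bases X) (inj₂ refl))

  indep⇒indep′ : ∀ {I} → Indep M I → Indep M′ I
  indep⇒indep′ ind with B , basis , I⊆B ← extend-to-basis M ind =
    hereditary M′ I⊆B (proj₁ (Equivalence.from (bases B) (inj₁ basis)))

  -- A basis of `M′` above `I` is either a basis of `M` or `X` itself, and in the second case `I` is
  -- a proper subset of a circuit.
  indep′⇒indep : ∀ {I} → Indep M′ I → I ≢ X → Indep M I
  indep′⇒indep ind I≢X with B , basis , I⊆B ← extend-to-basis M′ ind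
    with Equivalence.to (bases B) basis
  ... | inj₁ basisM = hereditary M I⊆B (proj₁ basisM)
  ... | inj₂ refl   = ⊂X⇒indep (⊆∧≢⇒⊂ I⊆B I≢X)

  rank′-X : rank M′ X ≡ r
  rank′-X = trans (rank-indep M′ indep′-X) ∣X∣≡r

  -- X is closed in M, so a set properly containing X spans M.
  rank-⊃X : ∀ {A} → X ⊂ A → r ≤ rank M A
  rank-⊃X (X⊆A , e , e∈A , e∉X) = ≤-trans
    (subst (_≤ rank M (X ∪ ⁅ e ⁆)) suc-rank-X (proj₁ hyperplane e e∉X))
    (rank-mono M (∪⁅⁆-⊆ X⊆A e∈A))

  -- A maximum independent set of `M′` inside `A` is independent in `M` unless it is `X`; then `A`
  -- contains `X` properly and spans `M`.
  rank′≡rank : ∀ {A} → A ≢ X → rank M′ A ≡ rank M A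
  rank′≡rank {A} A≢X with I , ind , I⊆A , ∣I∣≡ ← rank-attained M A
    | I′ , ind′ , I′⊆A , ∣I′∣≡ ← rank-attained M′ A =
    ≤-antisym (subst (_≤ rank M A) ∣I′∣≡ ≤₁)
              (subst (_≤ rank M′ A) ∣I∣≡ (indep⇒≤rank M′ (indep⇒indep′ ind) I⊆A))
    where
    ≤₁ : ∣ I′ ∣ ≤ rank M A
    ≤₁ with I′ ≟ˢ X
    ... | no I′≢X  = indep⇒≤rank M (indep′⇒indep ind′ I′≢X) I′⊆A
    ... | yes refl = subst (_≤ rank M A) (sym ∣X∣≡r) (rank-⊃X (⊆∧≢⇒⊂ I′⊆A (A≢X ∘ sym)))

  -- The sets X − e, the only flats of M′ that are not flats of M.
  Near : Subset n → Set
  Near F = F ⊆ X × suc ∣ F ∣ ≡ r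

  near⇒⊂X : ∀ {F} → Near F → F ⊂ X
  near⇒⊂X (F⊆X , eq) = ⊆∧≢⇒⊂ F⊆X λ { refl → 1+n≢n (trans eq (sym ∣X∣≡r)) }

  near-⊇ : ∀ {A} → A ⊂ X → ∃ λ F → Near F × A ⊆ F
  near-⊇ (A⊆X , x , x∈X , x∉A) = X - x , (p─q⊆p X ⁅ x ⁆ , trans (suc∣p-e∣≡∣p∣ x∈X) ∣X∣≡r)
    , λ y∈A → x∈p∧x≢y⇒x∈p-y (A⊆X y∈A) λ { refl → x∉A y∈A }

  -- `X ∪ ⁅ e ⁆` spans `M`, so it contains an independent set from which `F` can be augmented. An
  -- augmenting element in `X` would turn `F` into the dependent set `X`; hence it is `e`.
  near-∪-indep : ∀ {F e} → Near F → e ∉ X → Indep M (F ∪ ⁅ e ⁆)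
  near-∪-indep {F} {e} near e∉X with rank-attained M (X ∪ ⁅ e ⁆)
  ... | I , ind , I⊆ , ∣I∣≡
    with x , x∈I , x∉F , ind′ ← augment M (⊂X⇒indep (near⇒⊂X near)) ind
           (subst (_≤ ∣ I ∣) (sym (proj₂ near)) (subst (r ≤_) (sym ∣I∣≡)
             (rank-⊃X (A⊆A∪⁅e⁆ X e , e , e∈∪⁅e⁆ X e , e∉X))))
    with x∈p∪q⁻ X ⁅ e ⁆ (I⊆ x∈I)
  ... | inj₂ x∈e with refl ← x∈⁅y⁆⇒x≡y e x∈e = ind′
  ... | inj₁ x∈X = contradiction (subst (Indep M) F∪x≡X ind′) (proj₁ circuit)
    where
    F∪x≡X : F ∪ ⁅ x ⁆ ≡ X
    F∪x≡X = ⊆∧≥⇒≡ (∪⁅⁆-⊆ (proj₁ near) x∈X)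
      (≤-reflexive (trans ∣X∣≡r (trans (sym (proj₂ near)) (sym (∣p∪⁅e⁆∣≡1+∣p∣ F x x∉F)))))

  ⊂X-∪-indep : ∀ {A e} → A ⊂ X → e ∉ X → Indep M (A ∪ ⁅ e ⁆)
  ⊂X-∪-indep {A} {e} A⊂X e∉X with F , near , A⊆F ← near-⊇ A⊂X =
    hereditary M (∪⁅⁆-⊆ (A⊆A∪⁅e⁆ F e ∘ A⊆F) (e∈∪⁅e⁆ F e)) (near-∪-indep near e∉X)

  rank-⊂X : ∀ {A} → A ⊂ X → rank M A ≡ ∣ A ∣
  rank-⊂X A⊂X = rank-indep M (⊂X⇒indep A⊂X)

  ⊂X⇒≢X : ∀ {A} → A ⊂ X → A ≢ X
  ⊂X⇒≢X A⊂X refl = ⊂-irref refl A⊂X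

  rank′-⊂X : ∀ {A} → A ⊂ X → rank M′ A ≡ ∣ A ∣
  rank′-⊂X A⊂X = trans (rank′≡rank (⊂X⇒≢X A⊂X)) (rank-⊂X A⊂X)

  ⊆X∧<r⇒⊂X : ∀ {A} → A ⊆ X → ∣ A ∣ < r → A ⊂ X
  ⊆X∧<r⇒⊂X A⊆X lt = ⊆∧≢⇒⊂ A⊆X λ { refl → <-irrefl ∣X∣≡r lt }

  -- Adding an element of `X` stays inside `X`, which is independent in `M′`. This covers the sets
  -- `X − e`, where the result is `X` itself.
  ⊂X-flat′ : ∀ {A} → A ⊂ X → IsFlat M′ A
  ⊂X-flat′ {A} A⊂X e e∉A with e ∈? X
  ... | yes e∈X = indep-∪-<-rank M′ (hereditary M′ (∪⁅⁆-⊆ (proj₁ A⊂X) e∈X) indep′-X) e∉A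
  ... | no e∉X  = indep-∪-<-rank M′ (indep⇒indep′ (⊂X-∪-indep A⊂X e∉X)) e∉A

  -- The bound leaves room for one more element of `X`: the enlarged set is still a proper subset of
  -- the circuit, hence independent in `M`.
  ⊂X-flat : ∀ {A} → A ⊆ X → 2 + ∣ A ∣ ≤ r → IsFlat M A
  ⊂X-flat {A} A⊆X lt e e∉A with e ∈? X
  ... | yes e∈X = indep-∪-<-rank M
    (⊂X⇒indep (⊆X∧<r⇒⊂X (∪⁅⁆-⊆ A⊆X e∈X) (subst (_< r) (sym (∣p∪⁅e⁆∣≡1+∣p∣ A e e∉A)) lt))) e∉A
  ... | no e∉X  = indep-∪-<-rank M (⊂X-∪-indep (⊆X∧<r⇒⊂X A⊆X (<⇒≤ lt)) e∉X) e∉A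

  -- `X` has full rank in `M′`, yet `r < n` leaves an element outside it.
  X-notFlat′ : ¬ IsFlat M′ X
  X-notFlat′ flat with Fin.all? (_∈? X)
  ... | yes all = <-irrefl (trans (sym ∣X∣≡r) (trans (cong ∣_∣ (⊆-antisym ⊆⊤ (λ {x} _ → all x))) (∣⊤∣≡n n)))
                    (r<n R rk)
  ... | no ¬all with e , e∉X ← Fin.¬∀⟶∃¬ n (_∈ X) (_∈? X) ¬all =
    <⇒≱ (subst (_< rank M′ (X ∪ ⁅ e ⁆)) rank′-X (flat e e∉X))
        (subst (rank M′ (X ∪ ⁅ e ⁆) ≤_) rk′ (rank-mono M′ ⊆⊤))

  -- The missing element of `X` does not raise the rank, since `X` has rank `r − 1` in `M` just like
  -- `F`.
  near-notFlat : ∀ {F} → Near F → ¬ IsFlat M F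
  near-notFlat {F} near flat with F⊂X@(F⊆X , e , e∈X , e∉F) ← near⇒⊂X near =
    <⇒≱ (flat e e∉F) (≤-trans (rank-mono M (∪⁅⁆-⊆ F⊆X e∈X))
      (≤-reflexive (suc-injective (trans suc-rank-X (sym (trans (cong suc (rank-⊂X F⊂X)) (proj₂ near)))))))

  -- The rank of `F` is unchanged, and that of `F ∪ ⁅ e ⁆` can only grow, so the strict inequality
  -- survives even if `F ∪ ⁅ e ⁆` is `X`.
  flat⇒flat′ : ∀ {F} → IsFlat M F → F ≢ X → IsFlat M′ F
  flat⇒flat′ {F} flat F≢X e e∉F = subst (_< rank M′ (F ∪ ⁅ e ⁆)) (sym (rank′≡rank F≢X))
    (≤-trans (flat e e∉F) rank≤rank′)
    where
    rank≤rank′ : rank M (F ∪ ⁅ e ⁆) ≤ rank M′ (F ∪ ⁅ e ⁆)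
    rank≤rank′ with I , ind , I⊆ , eq ← rank-attained M (F ∪ ⁅ e ⁆) =
      subst (_≤ rank M′ (F ∪ ⁅ e ⁆)) eq (indep⇒≤rank M′ (indep⇒indep′ ind) I⊆)

  -- The strict inequality could be lost only when `F ∪ ⁅ e ⁆` is `X`, and then `F` is near.
  flat′⇒flat : ∀ {F} → IsFlat M′ F → ¬ Near F → IsFlat M F
  flat′⇒flat {F} flat ¬near e e∉F with (F ∪ ⁅ e ⁆) ≟ˢ X
  ... | yes F∪e≡X = ⊥-elim (¬near
    (subst (λ A → F ⊆ A) F∪e≡X (A⊆A∪⁅e⁆ F e)
    , trans (sym (∣p∪⁅e⁆∣≡1+∣p∣ F e e∉F)) (trans (cong ∣_∣ F∪e≡X) ∣X∣≡r)))
  ... | no F∪e≢X  = subst₂ (λ a b → a < b) (rank′≡rank F≢X) (rank′≡rank F∪e≢X) (flat e e∉F)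
    where
    F≢X : F ≢ X
    F≢X refl = X-notFlat′ flat

-- The 𝒢-invariant

module _ {n : ℕ} where

  -- Uniqueness rephrased along the accumulating sets used by `increments`: what the next entry must
  -- avoid is a single set `A`, not a list of inequalities.
  Fresh : ∀ {k} → Subset n → Vec (Fin n) k → Set
  Fresh A []       = Unit.⊤
  Fresh A (e ∷ es) = e ∉ A × Fresh (A ∪ ⁅ e ⁆) es

  fresh? : ∀ {k} A → Decidable (Fresh {k} A)
  fresh? A []       = yes _
  fresh? A (e ∷ es) = ¬? (e ∈? A) ×-dec fresh? (A ∪ ⁅ e ⁆) es

  unique⇒fresh : ∀ {k A} {es : Vec (Fin n) k} → VecAll.All (_∉ A) es → Unique es → Fresh A es
  unique⇒fresh VecAll.[] [] = _
  unique⇒fresh {A = A} {e ∷ es} (e∉A VecAll.∷ ∉A) (e≢ ∷ u) =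
    e∉A , unique⇒fresh (VecAll.map ∉∪ (VecAll.zip (∉A , e≢))) u
    where
    ∉∪ : ∀ {x} → x ∉ A × e ≢ x → x ∉ A ∪ ⁅ e ⁆
    ∉∪ (x∉A , e≢x) = [ x∉A , (λ x∈e → e≢x (sym (x∈⁅y⁆⇒x≡y e x∈e))) ]′ ∘ x∈p∪q⁻ A ⁅ e ⁆

  fresh⇒unique : ∀ {k A} (es : Vec (Fin n) k) → Fresh A es → VecAll.All (_∉ A) es × Unique es
  fresh⇒unique []       _ = VecAll.[] , []
  fresh⇒unique {A = A} (e ∷ es) (e∉A , fr) with ∉A∪e , u ← fresh⇒unique es fr =
    e∉A VecAll.∷ VecAll.map (_∘ A⊆A∪⁅e⁆ A e) ∉A∪e ,
    VecAll.map (λ { x∉ refl → x∉ (e∈∪⁅e⁆ A e) }) ∉A∪e ∷ u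

  private
    ∣A∪e∣+k : ∀ {A : Subset n} {e k l} → e ∉ A → ∣ A ∣ + suc k ≡ l → ∣ A ∪ ⁅ e ⁆ ∣ + k ≡ l
    ∣A∪e∣+k {A} {e} {k} e∉A eq =
      trans (cong (_+ k) (∣p∪⁅e⁆∣≡1+∣p∣ A e e∉A)) (trans (sym (+-suc ∣ A ∣ k)) eq)

  count-fresh : ∀ k A → ∣ A ∣ + k ≡ n → count (fresh? {k} A) (vectors (allFin n) k) ≡ k !
  count-fresh zero    A eq = refl
  count-fresh (suc k) A eq = trans
    (count-vectors (_∈? ∁ A) (fresh? A) (λ (e∉A , _) → x∉p⇒x∈∁p e∉A) (allFin n)
      λ {e} e∈ → trans
        (count-cong (λ es → fresh? A (e ∷ es)) (fresh? (A ∪ ⁅ e ⁆)) proj₂ (x∈∁p⇒x∉p e∈ ,_) (vectors (allFin n) k))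
        (count-fresh k (A ∪ ⁅ e ⁆) (∣A∪e∣+k (x∈∁p⇒x∉p e∈) eq)))
    (cong (_* k !) (trans (count-allFin-∈ (∁ A)) (trans (∣∁p∣≡n∸∣p∣ A)
      (trans (cong (_∸ ∣ A ∣) (sym eq)) (m+n∸m≡n ∣ A ∣ (suc k))))))

  module _ (X : Subset n) where

    -- Hit ⊥ π says that the first ∣ X ∣ entries of a permutation π form X.
    Hit : ∀ {k} → Subset n → Vec (Fin n) k → Set
    Hit A []       = A ≡ X
    Hit A (e ∷ es) = A ≡ X ⊎ Hit (A ∪ ⁅ e ⁆) es

    hit? : ∀ {k} A → Decidable (Hit {k} A)
    hit? A []       = A ≟ˢ X
    hit? A (e ∷ es) = (A ≟ˢ X) ⊎-dec hit? (A ∪ ⁅ e ⁆) es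

    hit-X : ∀ {k} (es : Vec (Fin n) k) → Hit X es
    hit-X []       = refl
    hit-X (e ∷ es) = inj₁ refl

    hit⇒⊆ : ∀ {k A} (es : Vec (Fin n) k) → Hit A es → A ⊆ X
    hit⇒⊆ []       refl        = id
    hit⇒⊆ (e ∷ es) (inj₁ refl) = id
    hit⇒⊆ {A = A} (e ∷ es) (inj₂ hit) = hit⇒⊆ es hit ∘ A⊆A∪⁅e⁆ A e

    hit-∷ : ∀ {k A e} {es : Vec (Fin n) k} → A ≢ X → Hit A (e ∷ es) → Hit (A ∪ ⁅ e ⁆) es
    hit-∷ A≢X = [ (λ A≡X → contradiction A≡X A≢X) , id ]′

    -- `m` elements of `X` are still missing. Until they are used up, the next entry has to come
    -- from `X ─ A`; after that the remaining entries are arbitrary fresh ones.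
    count-hit : ∀ m k A → A ⊆ X → ∣ A ∣ + m ≡ ∣ X ∣ → ∣ A ∣ + k ≡ n →
                count (λ es → fresh? {k} A es ×-dec hit? A es) (vectors (allFin n) k) ≡ m ! * (k ∸ m) !
    count-hit zero k A A⊆X eqX eqn
      with refl ← ⊆∧≥⇒≡ A⊆X (≤-reflexive (trans (sym eqX) (+-identityʳ _))) = trans
      (count-cong (λ es → fresh? X es ×-dec hit? X es) (fresh? X) proj₁ (λ {es} fr → fr , hit-X es)
        (vectors (allFin n) k))
      (trans (count-fresh k X eqn) (sym (+-identityʳ (k !))))
    -- No entries are left, so `A` has all `n` elements, while `X` would have more.
    count-hit (suc m) zero A A⊆X eqX eqn = contradiction (∣p∣≤n X)
      (<⇒≱ (subst₂ _<_ (trans (sym (+-identityʳ _)) eqn) eqX (m<m+n ∣ A ∣ z<s)))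
    count-hit (suc m) (suc k) A A⊆X eqX eqn = trans
      (count-vectors (_∈? (X ─ A)) (λ es → fresh? A es ×-dec hit? A es)
        (λ {e} {es} ((e∉A , _) , hit) → x∈p∧x∉q⇒x∈p─q (hit⇒⊆ es (hit-∷ A≢X hit) (e∈∪⁅e⁆ A e)) e∉A)
        (allFin n)
        λ {e} e∈ → let e∉A = x∈p─q⇒x∉q X A e∈ in trans
          (count-cong (λ es → fresh? A (e ∷ es) ×-dec hit? A (e ∷ es))
                      (λ es → fresh? (A ∪ ⁅ e ⁆) es ×-dec hit? (A ∪ ⁅ e ⁆) es)
                      (λ ((_ , fr) , hit) → fr , hit-∷ A≢X hit) (λ (fr , hit) → (e∉A , fr) , inj₂ hit)
                      (vectors (allFin n) k))
          (count-hit m k (A ∪ ⁅ e ⁆) (∪⁅⁆-⊆ A⊆X (p─q⊆p X A e∈)) (∣A∪e∣+k e∉A eqX) (∣A∪e∣+k e∉A eqn)))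
      (trans (cong (_* (m ! * (k ∸ m) !)) (trans (count-allFin-∈ (X ─ A)) (trans (∣p─q∣≡∣p∣∸∣q∣ X A A⊆X)
               (trans (cong (_∸ ∣ A ∣) (sym eqX)) (m+n∸m≡n ∣ A ∣ (suc m))))))
             (sym (*-assoc (suc m) (m !) ((k ∸ m) !))))
      where
      A≢X : A ≢ X
      A≢X refl = m≢1+m+n _ (trans (sym eqX) (+-suc ∣ A ∣ m))

increments-spanning : ∀ {n k} (M : Matroid n) {A} (es : Vec (Fin n) k) →
                      rank M ⊤ ≤ rank M A → increments M A es ≡ 0^ k
increments-spanning M []       _  = refl
increments-spanning M {A} (e ∷ es) le = cong₂ _∷_
  (m≤n⇒m∸n≡0 (≤-trans (rank-mono M {B = ⊤} ⊆⊤) le))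
  (increments-spanning M es (≤-trans le (rank-mono M (A⊆A∪⁅e⁆ A e))))

count-toList : ∀ {a p q} {A : Set a} {P : Pred A p} {Q : Pred A q} (Q? : Decidable Q) {xs} (pxs : All P xs) →
               count (Q? ∘ proj₁) (All.toList pxs) ≡ count Q? xs
count-toList Q? []               = refl
count-toList Q? {x ∷ xs} (_ ∷ pxs) with Q? x
... | yes _ = cong suc (count-toList Q? pxs)
... | no _  = count-toList Q? pxs

module _ {n r} {M M′ : Matroid n} {X : Subset n} (R : IsRelaxation M X M′) (rk : rank M ⊤ ≡ r) where

  open Relax R rk

  private
    rank-X∪e : ∀ {e} → e ∉ X → rank M (X ∪ ⁅ e ⁆) ≡ suc (rank M X)
    rank-X∪e {e} e∉X = ≤-antisym (rank-∪⁅⁆ M X e) (proj₁ hyperplane e e∉X)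

  -- None of the accumulated sets is `X`, so every rank that occurs is common to both matroids.
  ¬hit⇒increments≡ : ∀ {k} A (es : Vec (Fin n) k) → ¬ Hit X A es → increments M′ A es ≡ increments M A es
  ¬hit⇒increments≡ A []       _    = refl
  ¬hit⇒increments≡ A (e ∷ es) ¬hit = cong₂ _∷_
    (cong₂ _∸_ (rank′≡rank λ { A∪e≡X → ¬hit (inj₂ (subst (λ B → Hit X B es) (sym A∪e≡X) (hit-X X es))) })
               (rank′≡rank (¬hit ∘ inj₁)))
    (¬hit⇒increments≡ (A ∪ ⁅ e ⁆) es (¬hit ∘ inj₂))

  -- `suc m` elements of `X` are still to come. Proper subsets of `X` are independent in both
  -- matroids, so both increments are 1 until the last of these elements. That element raises only
  -- the rank in `M′`; the next entry lies outside the hyperplane and raises only the rank in `M`.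
  -- From then on both matroids are spanned.
  hit⇒increments : ∀ {k} m A (es : Vec (Fin n) k) → Fresh A es → Hit X A es →
    ∣ A ∣ + suc m ≡ r → ∣ A ∣ + k ≡ n →
    increments M′ A es ≡ 1^ (suc m) ++ 0^ (k ∸ suc m) ×
    increments M A es ≡ 1^ m ++ 0 ∷ 1 ∷ 0^ (k ∸ suc m ∸ 1)
  hit⇒increments {k} m A es fresh hit eqr eqn = go es fresh hit eqn
    where
    A≢X : A ≢ X
    A≢X refl = m≢1+m+n _ (trans (trans ∣X∣≡r (sym eqr)) (+-suc ∣ A ∣ m))
    go : ∀ {k} (es : Vec (Fin n) k) → Fresh A es → Hit X A es → ∣ A ∣ + k ≡ n →
      increments M′ A es ≡ 1^ (suc m) ++ 0^ (k ∸ suc m) ×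
      increments M A es ≡ 1^ m ++ 0 ∷ 1 ∷ 0^ (k ∸ suc m ∸ 1)
    go []       _ A≡X _ = contradiction A≡X A≢X
    go {suc k} (e ∷ es) (e∉A , fr) hit eqn with hit-∷ X A≢X hit
    ... | hit′ = by-cases m eqr
      where
      B = A ∪ ⁅ e ⁆
      B⊆X = hit⇒⊆ X es hit′
      A⊂X = ⊆∧≢⇒⊂ (B⊆X ∘ A⊆A∪⁅e⁆ A e) A≢X
      ∣B∣ = ∣p∪⁅e⁆∣≡1+∣p∣ A e e∉A
      eqn′ : ∣ B ∣ + k ≡ n
      eqn′ = trans (cong (_+ k) ∣B∣) (trans (sym (+-suc ∣ A ∣ k)) eqn)
      eqr′ : ∀ {m} → ∣ A ∣ + suc m ≡ r → ∣ B ∣ + m ≡ r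
      eqr′ {m} eqr = trans (cong (_+ m) ∣B∣) (trans (sym (+-suc ∣ A ∣ m)) eqr)
      by-cases : ∀ m → ∣ A ∣ + suc m ≡ r →
        increments M′ A (e ∷ es) ≡ 1^ (suc m) ++ 0^ (suc k ∸ suc m) ×
        increments M A (e ∷ es) ≡ 1^ m ++ 0 ∷ 1 ∷ 0^ (suc k ∸ suc m ∸ 1)
      by-cases zero eqr =
        cong₂ _∷_
          (trans (cong₂ _∸_ (trans (cong (rank M′) B≡X) rank′-X) (rank′-⊂X A⊂X))
                 (trans (cong (_∸ ∣ A ∣) (sym eqr)) (m+n∸m≡n ∣ A ∣ 1)))
          (increments-spanning M′ es (≤-reflexive (trans rk′ (sym (trans (cong (rank M′) B≡X) rank′-X)))))
        , cong₂ _∷_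
          (trans (cong₂ _∸_ (trans (cong (rank M) B≡X) rank-X≡∣A∣) (rank-⊂X A⊂X)) (n∸n≡0 ∣ A ∣))
          (subst (λ C → increments M C es ≡ 1 ∷ 0^ (k ∸ 1)) (sym B≡X)
            (from-X es (subst (λ C → Fresh C es) B≡X fr)
              (trans (cong (_+ k) (sym (trans (cong ∣_∣ B≡X) ∣X∣≡r))) eqn′)))
        where
        B≡X : B ≡ X
        B≡X = ⊆∧≥⇒≡ B⊆X (≤-reflexive (trans ∣X∣≡r (trans (sym (eqr′ eqr)) (+-identityʳ _))))
        rank-X≡∣A∣ : rank M X ≡ ∣ A ∣
        rank-X≡∣A∣ = suc-injective (trans suc-rank-X (trans (sym eqr) (+-comm ∣ A ∣ 1)))
        -- `r < n` ensures that an entry follows `X`.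
        from-X : ∀ {k} (es : Vec (Fin n) k) → Fresh X es → r + k ≡ n → increments M X es ≡ 1 ∷ 0^ (k ∸ 1)
        from-X [] _ eq = contradiction (trans (sym (+-identityʳ r)) eq) (<⇒≢ (r<n R rk))
        from-X (f ∷ es) (f∉X , _) _ = cong₂ _∷_
          (trans (cong (_∸ rank M X) (rank-X∪e f∉X)) (m+n∸n≡m 1 (rank M X)))
          (increments-spanning M es (≤-reflexive (trans (trans rk (sym suc-rank-X)) (sym (rank-X∪e f∉X)))))
      by-cases (suc m) eqr with ih′ , ih ← hit⇒increments m B es fr hit′ (eqr′ eqr) eqn′ =
        cong₂ _∷_ (trans (cong₂ _∸_ (rank′-⊂X B⊂X) (rank′-⊂X A⊂X)) one) ih′ ,
        cong₂ _∷_ (trans (cong₂ _∸_ (rank-⊂X B⊂X) (rank-⊂X A⊂X)) one) ih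
        where
        B⊂X : B ⊂ X
        B⊂X = ⊆X∧<r⇒⊂X B⊆X (subst (∣ B ∣ <_) (eqr′ eqr) (m<m+n ∣ B ∣ z<s))
        one : ∣ B ∣ ∸ ∣ A ∣ ≡ 1
        one = trans (cong (_∸ ∣ A ∣) ∣B∣) (m+n∸n≡m 1 ∣ A ∣)

  Hits : Permutation n → Set
  Hits (π , _) = Hit X ⊥ π

  hits? : Decidable Hits
  hits? = hit? X ⊥ ∘ proj₁

  count-hits : count hits? (permutations n) ≡ r ! * (n ∸ r) !
  count-hits = trans (count-toList (hit? X ⊥) (all-filter unique? vs))
    (trans (count-filter (hit? X ⊥) unique? vs)
    (trans (count-cong (λ π → unique? π ×-dec hit? X ⊥ π) (λ π → fresh? ⊥ π ×-dec hit? X ⊥ π)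
             (λ {π} (u , h) → unique⇒fresh (VecAll.universal (λ _ → ∉⊥) π) u , h)
             (λ {π} (fr , h) → proj₂ (fresh⇒unique π fr) , h) vs)
      (count-hit X r n ⊥ ⊥⊆ (trans (cong (_+ r) (∣⊥∣≡0 n)) (sym ∣X∣≡r)) (cong (_+ n) (∣⊥∣≡0 n)))))
    where vs = vectors (allFin n) n

  ¬hits⇒rankSequence≡ : ∀ π → ¬ Hits π → rankSequence M′ π ≡ rankSequence M π
  ¬hits⇒rankSequence≡ (π , _) = ¬hit⇒increments≡ ⊥ π

  hits⇒rankSequence : ∀ π → Hits π →
    rankSequence M′ π ≡ 1^ r ++ 0^ (n ∸ r) ×
    rankSequence M π ≡ 1^ (r ∸ 1) ++ 0 ∷ 1 ∷ 0^ (n ∸ r ∸ 1)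
  hits⇒rankSequence (π , u) hit = subst
    (λ s → increments M′ ⊥ π ≡ 1^ s ++ 0^ (n ∸ s) × increments M ⊥ π ≡ 1^ (r ∸ 1) ++ 0 ∷ 1 ∷ 0^ (n ∸ s ∸ 1))
    1+[r∸1]≡r
    (hit⇒increments (r ∸ 1) ⊥ π (unique⇒fresh (VecAll.universal (λ _ → ∉⊥) π) u) hit
      (trans (cong (_+ suc (r ∸ 1)) (∣⊥∣≡0 n)) 1+[r∸1]≡r) (cong (_+ n) (∣⊥∣≡0 n)))
    where
    1+[r∸1]≡r : suc (r ∸ 1) ≡ r
    1+[r∸1]≡r = m+[n∸m]≡n (0<r R rk)

module _ {c ℓ m ℓm} {R : CommutativeRing c ℓ} (V : Module R m ℓm) where

  private
    module F = CommutativeRing R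
    module V = Module V
  open V

  -- Terms outside `P` cancel, and each term in `P` contributes the same vector `w`, so only their
  -- number matters.
  sum-difference : ∀ {b p} {B : Set b} {P : Pred B p} (P? : Decidable P) (f g : B → Carrierᴹ) (w : Carrierᴹ) →
    (∀ x → P x → f x +ᴹ (-ᴹ g x) ≈ᴹ w) → (∀ x → ¬ P x → f x ≈ᴹ g x) → ∀ xs →
    foldr _+ᴹ_ 0ᴹ (map f xs) +ᴹ (-ᴹ foldr _+ᴹ_ 0ᴹ (map g xs)) ≈ᴹ
      RawMonoid._×_ F.+-rawMonoid (count P? xs) F.1# *ₗ w
  sum-difference P? f g w yes-diff no-diff = go
    where
    open SetoidReasoning ≈ᴹ-setoid
    open AbelianGroupProperties +ᴹ-abelianGroup using (⁻¹-∙-comm)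
    open CommutativeSemigroupProperties (AbelianGroup.commutativeSemigroup +ᴹ-abelianGroup) using (interchange)
    Σ′ : _ → _ → _
    Σ′ h xs = foldr _+ᴹ_ 0ᴹ (map h xs)
    step : ∀ x xs → Σ′ f (x ∷ xs) +ᴹ (-ᴹ Σ′ g (x ∷ xs)) ≈ᴹ (f x +ᴹ (-ᴹ g x)) +ᴹ (Σ′ f xs +ᴹ (-ᴹ Σ′ g xs))
    step x xs = begin
      (f x +ᴹ Σ′ f xs) +ᴹ (-ᴹ (g x +ᴹ Σ′ g xs))           ≈⟨ +ᴹ-congˡ (⁻¹-∙-comm (g x) (Σ′ g xs)) ⟨
      (f x +ᴹ Σ′ f xs) +ᴹ ((-ᴹ g x) +ᴹ (-ᴹ Σ′ g xs))      ≈⟨ interchange _ _ _ _ ⟩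
      (f x +ᴹ (-ᴹ g x)) +ᴹ (Σ′ f xs +ᴹ (-ᴹ Σ′ g xs))      ∎
    go : ∀ xs → Σ′ f xs +ᴹ (-ᴹ Σ′ g xs) ≈ᴹ RawMonoid._×_ F.+-rawMonoid (count P? xs) F.1# *ₗ w
    go []       = ≈ᴹ-trans (-ᴹ‿inverseʳ 0ᴹ) (≈ᴹ-sym (*ₗ-zeroˡ w))
    go (x ∷ xs) with P? x
    ... | yes Px = begin
      Σ′ f (x ∷ xs) +ᴹ (-ᴹ Σ′ g (x ∷ xs))                  ≈⟨ step x xs ⟩
      (f x +ᴹ (-ᴹ g x)) +ᴹ (Σ′ f xs +ᴹ (-ᴹ Σ′ g xs))       ≈⟨ +ᴹ-cong
        (≈ᴹ-trans (yes-diff x Px) (≈ᴹ-sym (*ₗ-identityˡ w))) (go xs) ⟩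
      (F.1# *ₗ w) +ᴹ (N *ₗ w)                              ≈⟨ *ₗ-distribʳ w F.1# N ⟨
      (F.1# F.+ N) *ₗ w                                    ∎
      where N = RawMonoid._×_ F.+-rawMonoid (count P? xs) F.1#
    ... | no ¬Px = begin
      Σ′ f (x ∷ xs) +ᴹ (-ᴹ Σ′ g (x ∷ xs))                  ≈⟨ step x xs ⟩
      (f x +ᴹ (-ᴹ g x)) +ᴹ (Σ′ f xs +ᴹ (-ᴹ Σ′ g xs))       ≈⟨ +ᴹ-cong
        (≈ᴹ-trans (+ᴹ-congʳ (no-diff x ¬Px)) (-ᴹ‿inverseʳ (g x))) (go xs) ⟩
      0ᴹ +ᴹ _                                              ≈⟨ +ᴹ-identityˡ _ ⟩
      _                                                    ∎

module _ {c ℓ₁ ℓ₂} (K : HeytingField c ℓ₁ ℓ₂) {n r} {M M′ : Matroid n} {X : Subset n}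
         (rk : rank M ⊤ ≡ r) (R : IsRelaxation M X M′) where

  open 𝒢 K {n} {r}
  private module F = CommutativeRing (commutativeRing K)

  -- The value at `u` of the symbol with underlying list `w`. Working on bare lists lets equal rank
  -- sequences be exchanged whatever their proofs of `IsWord`.
  coefficient : Word n r → List ℕ → F.Carrier
  coefficient u w = if does (List.≡-dec _≟_ w (proj₁ u)) then F.1# else F.0#

  coefficient-cong : ∀ {v w} → v ≡ w → ∀ u → coefficient u v F.≈ coefficient u w
  coefficient-cong eq u = F.reflexive (cong (coefficient u) eq)

  𝒢-difference : 𝒢-invariant M′ (relaxation-rank R rk) -ᴹ 𝒢-invariant M rk
        ≈ᴹ fromℕ K (r ! * (n ∸ r) !) *ₗ
             ([ 1^ r ++ 0^ (n ∸ r) , 1^r0^[n-r]-isWord (r<n R rk) ]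
               -ᴹ [ 1^ (r ∸ 1) ++ 0 ∷ 1 ∷ 0^ (n ∸ r ∸ 1)
                    , 1^[r-1]010^[n-r-1]-isWord (0<r R rk) (r<n R rk) ])
  𝒢-difference = subst
    (λ N → 𝒢-invariant M′ (relaxation-rank R rk) -ᴹ 𝒢-invariant M rk ≈ᴹ fromℕ K N *ₗ _)
    (count-hits R rk)
    (sum-difference (𝒢Space K n r) (hits? R rk)
      (λ π → [ rankSequence M′ π , rankSequence-isWord M′ (relaxation-rank R rk) π ])
      (λ π → [ rankSequence M π , rankSequence-isWord M rk π ]) _
      (λ π hit → let eq′ , eq = hits⇒rankSequence R rk π hit in
        λ t → F.+-cong (coefficient-cong eq′ t) (F.-‿cong (coefficient-cong eq t)))
      (λ π ¬hit → coefficient-cong (¬hits⇒rankSequence≡ R rk π ¬hit))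
      (permutations n))

-- Flags

falling : ℕ → ℕ → ℕ
falling d       zero    = 1
falling zero    (suc k) = 0
falling (suc d) (suc k) = suc d * falling d k

-- With `m = 1` this gives the `r !` gained flags; with `m = 2` the factor `2 !` is the denominator
-- in the number of lost flags.
falling-! : ∀ m k → falling (k + m) k * m ! ≡ (k + m) !
falling-! m zero    = +-identityʳ (m !)
falling-! m (suc k) = trans (*-assoc (suc (k + m)) (falling (k + m) k) (m !))
  (cong (suc (k + m) *_) (falling-! m k))

module _ {n} (N : Matroid n) where

  -- Ys completes a chain that has reached A to a flag; j is the rank of the first entry of Ys.
  Extends : ∀ {k} → ℕ → Subset n → Vec (Subset n) k → Set
  Extends j A []       = A ≡ ⊤
  Extends j A (Y ∷ Ys) = A ⊂ Y × (IsFlat N Y × rank N Y ≡ j) × Extends (suc j) Y Ys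

  extends⁺ : ∀ {k} j {A} (Ys : Vec (Subset n) k) → Linked _⊂_ (A ∷ Ys) →
             (∀ i → IsFlat N (lookup Ys i) × rank N (lookup Ys i) ≡ j + toℕ i) → last (A ∷ Ys) ≡ ⊤ →
             Extends j A Ys
  extends⁺ j []       _              _     A≡⊤    = A≡⊤
  extends⁺ j (Y ∷ Ys) (A⊂Y ∷ linked) flats last≡⊤ =
    A⊂Y , (proj₁ (flats zero) , trans (proj₂ (flats zero)) (+-identityʳ j)) ,
    extends⁺ (suc j) Ys linked
      (λ i → proj₁ (flats (suc i)) , trans (proj₂ (flats (suc i))) (+-suc j (toℕ i))) last≡⊤

  extends⁻ : ∀ {k} j {A} (Ys : Vec (Subset n) k) → Extends j A Ys →
             Linked _⊂_ (A ∷ Ys) ×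
             (∀ i → IsFlat N (lookup Ys i) × rank N (lookup Ys i) ≡ j + toℕ i) × last (A ∷ Ys) ≡ ⊤
  extends⁻ j []       A≡⊤ = [-] , (λ ()) , A≡⊤
  extends⁻ j (Y ∷ Ys) (A⊂Y , (flat , rk) , ext) with linked , flats , last≡⊤ ← extends⁻ (suc j) Ys ext =
    A⊂Y ∷ linked ,
    (λ { zero    → flat , trans rk (sym (+-identityʳ j))
       ; (suc i) → proj₁ (flats i) , trans (proj₂ (flats i)) (sym (+-suc j (toℕ i))) }) ,
    last≡⊤

  flag⇒extends : ∀ {k A} {Ys : Vec (Subset n) k} → IsFlag N (A ∷ Ys) → Extends 1 A Ys
  flag⇒extends {Ys = Ys} (linked , flats , last≡⊤) = extends⁺ 1 Ys linked (flats ∘ suc) last≡⊤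

  extends⇒flag : ∀ {k A} {Ys : Vec (Subset n) k} → IsFlat N A → rank N A ≡ 0 → Extends 1 A Ys →
                 IsFlag N (A ∷ Ys)
  extends⇒flag {Ys = Ys} flat rk ext with linked , flats , last≡⊤ ← extends⁻ 1 Ys ext =
    linked , (λ { zero → flat , rk ; (suc i) → flats i }) , last≡⊤

  extends⇒⊂ : ∀ {k} j {A} (Ys : Vec (Subset n) k) → Extends j A Ys → ∀ i → A ⊂ lookup Ys i
  extends⇒⊂ j (Y ∷ Ys) (A⊂Y , _)       zero    = A⊂Y
  extends⇒⊂ j (Y ∷ Ys) (A⊂Y , _ , ext) (suc i) = ⊂-trans A⊂Y (extends⇒⊂ (suc j) Ys ext i)

  -- The ranks of `M` and `M′` agree only propositionally; the index `l` puts the flags of both into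
  -- one list of vectors.
  ν-count : ∀ {l} → rank N ⊤ ≡ l → ∀ a → ν N a ≡
    count (λ Xs → isFlag? N Xs ×-dec List.≡-dec _≟_ (composition Xs) a) (vectors (subsets n) (suc l))
  ν-count refl a = count-filter (λ Xs → List.≡-dec _≟_ (composition Xs) a) (isFlag? N) (vectors (subsets n) _)

-- Chains inside `X` growing by one element at a time

module _ {n} (X : Subset n) where

  -- `k` one-element steps inside `X`, followed by exactly the tail `t`. The tail is `X , ⊤` for
  -- lost flags and `⊤` alone for gained ones, so one count serves both.
  Climb : ∀ {m} k → Vec (Subset n) m → Subset n → Vec (Subset n) (k + m) → Set
  Climb zero    t A v       = v ≡ t
  Climb (suc k) t A (Y ∷ v) = Step X A Y × Climb k t Y v

  climb? : ∀ {m} k (t : Vec (Subset n) m) A → Decidable (Climb k t A)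
  climb? zero    t A v       = Vec.≡-dec _≟ˢ_ v t
  climb? (suc k) t A (Y ∷ v) = step? X A Y ×-dec climb? k t Y v

  count-climb : ∀ {m} k (t : Vec (Subset n) m) {A} d → A ⊆ X → ∣ A ∣ + d ≡ ∣ X ∣ →
                count (climb? k t A) (vectors (subsets n) (k + m)) ≡ falling d k
  count-climb zero    t d A⊆X eq = count-vectors-≡ _≟ˢ_ (subsets n) count-subsets-≡ t
  count-climb {m} (suc k) t {A} d A⊆X eq = trans
    (count-vectors (step? X A) (climb? (suc k) t A) proj₁ (subsets n) λ {Y} step → trans
      (count-cong (λ v → climb? (suc k) t A (Y ∷ v)) (climb? k t Y) proj₂ (step ,_) (vectors (subsets n) (k + m)))
      -- `d` elements of `X` lie outside `A`. If `d` is 0, no step exists and the product vanishes,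
      -- in agreement with `falling`.
      (count-climb k t (pred d) (proj₁ (proj₂ step)) (∣Y∣+ d eq step)))
    (trans (cong (_* falling (pred d) k) (trans (count-step X A A⊆X)
             (trans (cong (_∸ ∣ A ∣) (sym eq)) (m+n∸m≡n ∣ A ∣ d))))
      (unfold d))
    where
    unfold : ∀ d → d * falling (pred d) k ≡ falling d (suc k)
    unfold zero    = refl
    unfold (suc d) = refl
    ∣Y∣+ : ∀ d {Y} → ∣ A ∣ + d ≡ ∣ X ∣ → Step X A Y → ∣ Y ∣ + pred d ≡ ∣ X ∣
    ∣Y∣+ zero    eq (_ , Y⊆X , ∣Y∣) = contradiction (p⊆q⇒∣p∣≤∣q∣ Y⊆X)
      (<⇒≱ (subst₂ _<_ (trans (sym (+-identityʳ _)) eq) (sym ∣Y∣) (n<1+n _)))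
    ∣Y∣+ (suc d) eq (_ , _ , ∣Y∣) = trans (cong (_+ d) ∣Y∣) (trans (sym (+-suc ∣ A ∣ d)) eq)

  -- `B` is the set reached after the `k` steps. Its size is known, which is all that is needed to
  -- evaluate the jumps into `t`.
  climb-differences : ∀ {m} k (t : Vec (Subset n) m) {A v} → A ⊆ X → Climb k t A v →
    ∃ λ B → B ⊆ X × ∣ B ∣ ≡ ∣ A ∣ + k × differences A v ≡ replicate k 1 ++ differences B t
  climb-differences zero    t {A} A⊆X refl = A , A⊆X , sym (+-identityʳ _) , refl
  climb-differences (suc k) t {A} {Y ∷ v} _ ((A⊆Y , Y⊆X , ∣Y∣) , climb)
    with B , B⊆X , ∣B∣ , eq ← climb-differences k t Y⊆X climb =
    B , B⊆X , trans ∣B∣ (trans (cong (_+ k) ∣Y∣) (sym (+-suc ∣ A ∣ k))) ,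
    cong₂ _∷_ (trans (∣p─q∣≡∣p∣∸∣q∣ Y A A⊆Y) (trans (cong (_∸ ∣ A ∣) ∣Y∣) (m+n∸n≡m 1 ∣ A ∣))) eq

  ClimbFrom⊥ : ∀ {m} k → Vec (Subset n) m → Vec (Subset n) (suc (k + m)) → Set
  ClimbFrom⊥ k t (Y ∷ v) = Y ≡ ⊥ × Climb k t ⊥ v

  climbFrom⊥? : ∀ {m} k (t : Vec (Subset n) m) → Decidable (ClimbFrom⊥ k t)
  climbFrom⊥? k t (Y ∷ v) = (Y ≟ˢ ⊥) ×-dec climb? k t ⊥ v

  count-climbFrom⊥ : ∀ {m} k (t : Vec (Subset n) m) →
    count (climbFrom⊥? k t) (vectors (subsets n) (suc (k + m))) ≡ falling ∣ X ∣ k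
  count-climbFrom⊥ {m} k t = trans
    (count-vectors (_≟ˢ ⊥) (climbFrom⊥? k t) proj₁ (subsets n) λ { refl → trans
      (count-cong (λ v → climbFrom⊥? k t (⊥ ∷ v)) (climb? k t ⊥) proj₂ (refl ,_) (vectors (subsets n) (k + m)))
      (count-climb k t ∣ X ∣ ⊥⊆ (cong (_+ ∣ X ∣) (∣⊥∣≡0 n))) })
    (trans (cong (_* falling ∣ X ∣ k) (count-subsets-≡ (⊥ {n}))) (+-identityʳ _))

-- Comparing two counts through what is lost and gained

module Balance {a} {A : Set a} (_≟ᴬ_ : DecidableEquality A) (f f′ lost gained : A → ℕ)
  {x y : A} {N : ℕ} (0<N : 0 < N)
  (balance : ∀ a → f′ a + lost a ≡ f a + gained a)
  (gained-≢x : ∀ a → a ≢ x → gained a ≡ 0) (gained-x : gained x ≡ N) (lost-x : lost x ≡ 0) where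

  balance⇒≡+ : ∀ {a l b g g′} → a + l ≡ b + g → l ≡ 0 → g ≡ g′ → a ≡ b + g′
  balance⇒≡+ {a} eq refl refl = trans (sym (+-identityʳ a)) eq

  ≡+⇒≢ : ∀ {a b c} → a ≡ b + c → 0 < c → a ≢ b
  ≡+⇒≢ {c = c} eq 0<c refl = <⇒≢ (m<m+n _ 0<c) eq

  ≡+⇒-≡ : ∀ {a b c} → b ≡ a + c → ℤ.+ a ≡ ℤ.+ b ℤ.- ℤ.+ c
  ≡+⇒-≡ {a} {c = c} refl = sym (begin
    ℤ.+ (a + c) ℤ.- ℤ.+ c  ≡⟨ ℤ.[+m]-[+n]≡m⊖n (a + c) c ⟩
    (a + c) ℤ.⊖ c          ≡⟨ ℤ.⊖-≥ (m≤n+m c a) ⟩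
    ℤ.+ (a + c ∸ c)        ≡⟨ cong ℤ.+_ (m+n∸n≡m a c) ⟩
    ℤ.+ a                  ∎)
    where open ≡-Reasoning

  half : ∀ {m n} → m * 2 ≡ n → m ≡ n / 2
  half {m} refl = sym (m*n/n≡m m 2)

  half-positive : ∀ {m n} → m * 2 ≡ n → 0 < n → 0 < m
  half-positive {suc m} _    _ = z<s
  half-positive {zero}  refl ()

  -- Makes no reference to `y`, since the first formula has to cover `r = 1` too, where the losses
  -- are not concentrated at `y`.
  f-x : f′ x ≡ f x + N
  f-x = balance⇒≡+ (balance x) lost-x gained-x

  module _ (x≢y : x ≢ y) (lost-≢y : ∀ a → a ≢ y → lost a ≡ 0) (lost-y : lost y * 2 ≡ N) where

    f-y : f y ≡ f′ y + lost y
    f-y = balance⇒≡+ {b = f′ y} {g = lost y} (sym (balance y)) (gained-≢x y (x≢y ∘ sym)) refl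

    f-y-ℤ : ℤ.+ f′ y ≡ ℤ.+ f y ℤ.- ℤ.+ (N / 2)
    f-y-ℤ = ≡+⇒-≡ (trans f-y (cong (f′ y +_) (half lost-y)))

    f-≢⇔ : ∀ a → (f′ a ≢ f a) ⇔ (a ≡ x ⊎ a ≡ y)
    f-≢⇔ a = mk⇔ to from
      where
      to : f′ a ≢ f a → a ≡ x ⊎ a ≡ y
      to f≢ with a ≟ᴬ x | a ≟ᴬ y
      ... | yes a≡x | _       = inj₁ a≡x
      ... | no _    | yes a≡y = inj₂ a≡y
      ... | no a≢x  | no a≢y  = contradiction
        (trans (balance⇒≡+ (balance a) (lost-≢y a a≢y) (gained-≢x a a≢x)) (+-identityʳ (f a))) f≢
      from : a ≡ x ⊎ a ≡ y → f′ a ≢ f a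
      from (inj₁ refl) = ≡+⇒≢ f-x 0<N
      from (inj₂ refl) = ≡+⇒≢ f-y (half-positive lost-y 0<N) ∘ sym

-- Flags lost and gained by the relaxation

module FlagCounts {n r} {M M′ : Matroid n} {X : Subset n} (R : IsRelaxation M X M′) (rk : rank M ⊤ ≡ r) where

  open Relax R rk

  near? : Decidable Near
  near? F = F ⊆? X ×-dec suc ∣ F ∣ ≟ r

  flag⇒flag′ : ∀ {k} (Xs : Vec (Subset n) (suc k)) → IsFlag M Xs → (∀ i → lookup Xs i ≢ X) → IsFlag M′ Xs
  flag⇒flag′ Xs (linked , flats , last≡⊤) ≢X = linked ,
    (λ i → flat⇒flat′ (proj₁ (flats i)) (≢X i) , trans (rank′≡rank (≢X i)) (proj₂ (flats i))) , last≡⊤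

  flag′⇒flag : ∀ {k} (Xs : Vec (Subset n) (suc k)) → IsFlag M′ Xs → (∀ i → ¬ Near (lookup Xs i)) → IsFlag M Xs
  flag′⇒flag Xs (linked , flats , last≡⊤) ¬near = linked ,
    (λ i → flat′⇒flat (proj₁ (flats i)) (¬near i) ,
           trans (sym (rank′≡rank λ eq → X-notFlat′ (subst (IsFlat M′) eq (proj₁ (flats i))))) (proj₂ (flats i))) ,
    last≡⊤

  Lost Gained : ∀ {k} → Vec (Subset n) (suc k) → Set
  Lost   Xs = IsFlag M Xs × ¬ IsFlag M′ Xs
  Gained Xs = IsFlag M′ Xs × ¬ IsFlag M Xs

  lost⇒X : ∀ {k} (Xs : Vec (Subset n) (suc k)) → Lost Xs → ∃ λ i → lookup Xs i ≡ X
  lost⇒X Xs (flag , ¬flag′) with Fin.any? (λ i → lookup Xs i ≟ˢ X)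
  ... | yes found = found
  ... | no none   = contradiction (flag⇒flag′ Xs flag λ i eq → none (i , eq)) ¬flag′

  gained⇒near : ∀ {k} (Xs : Vec (Subset n) (suc k)) → Gained Xs → ∃ λ i → Near (lookup Xs i)
  gained⇒near Xs (flag′ , ¬flag) with Fin.any? (λ i → near? (lookup Xs i))
  ... | yes found = found
  ... | no none   = contradiction (flag′⇒flag Xs flag′ λ i near → none (i , near)) ¬flag

  X⊂⊤ : X ⊂ ⊤
  X⊂⊤ = ⊆∧≢⇒⊂ ⊆⊤ λ X≡⊤ → <⇒≢ (r<n R rk) (trans (sym ∣X∣≡r) (trans (cong ∣_∣ X≡⊤) (∣⊤∣≡n n)))

  ⊤-flat : ∀ (N : Matroid n) → IsFlat N ⊤
  ⊤-flat N e e∉⊤ = contradiction ∈⊤ e∉⊤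

  ⊥⊂X : ⊥ ⊂ X
  ⊥⊂X = ⊆X∧<r⇒⊂X ⊥⊆ (subst (_< r) (sym (∣⊥∣≡0 n)) (0<r R rk))

  private
    shift : ∀ {j} k → j + suc k ≡ r → suc j + k ≡ r
    shift {j} k eq = trans (sym (+-suc j k)) eq

  -- The entries of `v` have ranks `j + 1` up to `r`, and `X` has rank `r − 1`, so `X` is the last
  -- entry but one. The entries before it are proper subsets of `X`; their rank is their size, so
  -- each step adds one element.
  extends⇒climb : ∀ k {j A} (v : Vec (Subset n) (k + 2)) → ∣ A ∣ ≡ j → j + (k + 2) ≡ r →
                  Extends M (suc j) A v → (∃ λ i → lookup v i ≡ X) → Climb X k (X ∷ ⊤ ∷ []) A v
  extends⇒climb zero (Y ∷ Z ∷ []) _ _ (_ , _ , _ , _ , refl) (zero , refl) = refl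
  extends⇒climb zero (Y ∷ Z ∷ []) _ _ (_ , _ , _ , _ , Z≡⊤)  (suc zero , Z≡X) =
    ⊥-elim (⊂-irref (trans (sym Z≡X) Z≡⊤) X⊂⊤)
  extends⇒climb (suc k) {j} (Y ∷ v) _ eq (_ , (_ , rkY) , _) (zero , refl)
    with () ← trans (+-comm 2 k) (suc-injective (+-cancelˡ-≡ j (suc k + 2) 2
                (trans eq (trans (trans (sym suc-rank-X) (cong suc rkY)) (+-comm 2 j)))))
  extends⇒climb (suc k) {j} {A} (Y ∷ v) ∣A∣ eq (A⊂Y , (_ , rkY) , ext) (suc i , Xi) =
    (proj₁ A⊂Y , proj₁ Y⊂X , trans ∣Y∣ (cong suc (sym ∣A∣))) , extends⇒climb k v ∣Y∣ (shift (k + 2) eq) ext (i , Xi)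
    where
    Y⊂X : Y ⊂ X
    Y⊂X = subst (Y ⊂_) Xi (extends⇒⊂ M _ v ext i)
    ∣Y∣ : ∣ Y ∣ ≡ suc j
    ∣Y∣ = trans (sym (rank-⊂X Y⊂X)) rkY

  climb⇒extends : ∀ k {j A} (v : Vec (Subset n) (k + 2)) → A ⊆ X → ∣ A ∣ ≡ j → j + (k + 2) ≡ r →
                  Climb X k (X ∷ ⊤ ∷ []) A v → Extends M (suc j) A v × (∃ λ i → lookup v i ≡ X)
  climb⇒extends zero {j} {A} _ A⊆X ∣A∣ eq refl =
    (⊆X∧<r⇒⊂X A⊆X (subst₂ _<_ (sym ∣A∣) eq (m<m+n j z<s)) ,
     (proj₁ hyperplane , rank-X) , X⊂⊤ , (⊤-flat M , trans rk (trans (sym suc-rank-X) (cong suc rank-X))) , refl) ,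
    zero , refl
    where
    rank-X : rank M X ≡ suc j
    rank-X = suc-injective (trans suc-rank-X (trans (sym eq) (+-comm j 2)))
  climb⇒extends (suc k) {j} {A} (Y ∷ v) A⊆X ∣A∣ eq ((A⊆Y , Y⊆X , ∣Y∣≡) , climb)
    with ext , i , Xi ← climb⇒extends k v Y⊆X (trans ∣Y∣≡ (cong suc ∣A∣)) (shift (k + 2) eq) climb =
    (⊆∧≢⇒⊂ A⊆Y (λ { refl → 1+n≢n (sym ∣Y∣≡) }) ,
     (⊂X-flat Y⊆X 2+∣Y∣≤r , trans (rank-⊂X (⊆X∧<r⇒⊂X Y⊆X (<⇒≤ 2+∣Y∣≤r))) ∣Y∣) , ext) ,
    suc i , Xi
    where
    ∣Y∣ : ∣ Y ∣ ≡ suc j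
    ∣Y∣ = trans ∣Y∣≡ (cong suc ∣A∣)
    -- `k + 2` further entries follow `Y`, each raising the rank by one up to `r`; so at least two
    -- elements of `X` are missing, as `⊂X-flat` demands.
    2+∣Y∣≤r : 2 + ∣ Y ∣ ≤ r
    2+∣Y∣≤r = subst₂ _≤_ (trans (+-comm (suc j) 2) (cong (2 +_) (sym ∣Y∣))) (shift (k + 2) eq)
      (+-monoʳ-≤ (suc j) (m≤n+m 2 k))

  near-∷⁻ : ∀ {k Y} {v : Vec (Subset n) k} i → Near (lookup (Y ∷ v) i) →
            Near Y ⊎ (∃ λ i → Near (lookup v i))
  near-∷⁻ zero    near = inj₁ near
  near-∷⁻ (suc i) near = inj₂ (i , near)

  -- A near set has rank `r − 1` in `M′` and so is the last entry before `⊤`. When the recursion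
  -- ends this entry is `A` itself, hence the alternative `Near A`.
  extends′⇒climb : ∀ k {j A} (v : Vec (Subset n) (k + 1)) → ∣ A ∣ ≡ j → j + (k + 1) ≡ r →
                   Extends M′ (suc j) A v → Near A ⊎ (∃ λ i → Near (lookup v i)) → Climb X k (⊤ ∷ []) A v
  extends′⇒climb zero (Z ∷ []) _ _ (_ , _ , refl) _ = refl
  extends′⇒climb (suc k) {j} {A} (Y ∷ v) ∣A∣ eq _ (inj₁ (_ , suc∣A∣≡r))
    with () ← trans (+-comm 1 k) (suc-injective (+-cancelˡ-≡ j (suc k + 1) 1
                (trans eq (trans (sym suc∣A∣≡r) (trans (cong suc ∣A∣) (+-comm 1 j))))))
  extends′⇒climb (suc k) {j} {A} (Y ∷ v) ∣A∣ eq (A⊂Y , (_ , rkY) , ext) (inj₂ (i , near)) =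
    (proj₁ A⊂Y , proj₁ Y⊂X , trans ∣Y∣ (cong suc (sym ∣A∣))) ,
    extends′⇒climb k v ∣Y∣ (shift (k + 1) eq) ext (near-∷⁻ i near)
    where
    Y⊂X : Y ⊂ X
    Y⊂X = [ near⇒⊂X , (λ (i , near) → ⊂-trans (extends⇒⊂ M′ _ v ext i) (near⇒⊂X near)) ]′ (near-∷⁻ i near)
    ∣Y∣ : ∣ Y ∣ ≡ suc j
    ∣Y∣ = trans (sym (rank′-⊂X Y⊂X)) rkY

  climb⇒extends′ : ∀ k {j A} (v : Vec (Subset n) (k + 1)) → A ⊆ X → ∣ A ∣ ≡ j → j + (k + 1) ≡ r →
                   Climb X k (⊤ ∷ []) A v → Extends M′ (suc j) A v × (∃ λ i → Near (lookup (A ∷ v) i))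
  climb⇒extends′ zero {j} {A} _ A⊆X ∣A∣ eq refl =
    (⊂-trans (near⇒⊂X near) X⊂⊤ , (⊤-flat M′ , trans rk′ (trans (sym eq) (+-comm j 1))) , refl) , zero , near
    where
    near : Near A
    near = A⊆X , trans (cong suc ∣A∣) (trans (+-comm 1 j) eq)
  climb⇒extends′ (suc k) {j} {A} (Y ∷ v) A⊆X ∣A∣ eq ((A⊆Y , Y⊆X , ∣Y∣≡) , climb)
    with ext , i , near ← climb⇒extends′ k v Y⊆X (trans ∣Y∣≡ (cong suc ∣A∣)) (shift (k + 1) eq) climb =
    (⊆∧≢⇒⊂ A⊆Y (λ { refl → 1+n≢n (sym ∣Y∣≡) }) ,
     (⊂X-flat′ Y⊂X , trans (rank′-⊂X Y⊂X) ∣Y∣) , ext) ,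
    suc i , near
    where
    ∣Y∣ : ∣ Y ∣ ≡ suc j
    ∣Y∣ = trans ∣Y∣≡ (cong suc ∣A∣)
    Y⊂X : Y ⊂ X
    Y⊂X = ⊆X∧<r⇒⊂X Y⊆X (subst₂ _<_ (sym ∣Y∣) (shift (k + 1) eq) (m<m+n (suc j) (≤-trans z<s (m≤n+m 1 k))))

  -- `X` cannot come first, as its rank `r − 1` is positive here. So the first entry is a proper
  -- subset of `X`, where rank 0 means empty.
  lost⇒climbFrom⊥ : ∀ k → k + 2 ≡ r → ∀ {Xs : Vec (Subset n) (suc (k + 2))} →
                    Lost Xs → ClimbFrom⊥ X k (X ∷ ⊤ ∷ []) Xs
  lost⇒climbFrom⊥ k k+2≡r {Y ∷ v} lost@(flag , _) with lost⇒X (Y ∷ v) lost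
  ... | zero , refl
    with () ← trans (+-comm 2 k) (trans k+2≡r (trans (sym suc-rank-X) (cong suc (proj₂ (proj₁ (proj₂ flag) zero)))))
  ... | suc i , Xi = Y≡⊥ , extends⇒climb k v (∣⊥∣≡0 n) k+2≡r (subst (λ A → Extends M 1 A v) Y≡⊥ ext) (i , Xi)
    where
    ext = flag⇒extends M flag
    Y⊂X : Y ⊂ X
    Y⊂X = subst (Y ⊂_) Xi (extends⇒⊂ M 1 v ext i)
    Y≡⊥ : Y ≡ ⊥
    Y≡⊥ = ∣p∣≡0⇒p≡⊥ (trans (sym (rank-⊂X Y⊂X)) (proj₂ (proj₁ (proj₂ flag) zero)))

  climbFrom⊥⇒lost : ∀ k → k + 2 ≡ r → ∀ {Xs : Vec (Subset n) (suc (k + 2))} →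
                    ClimbFrom⊥ X k (X ∷ ⊤ ∷ []) Xs → Lost Xs
  climbFrom⊥⇒lost k k+2≡r {Y ∷ v} (refl , climb)
    with ext , i , Xi ← climb⇒extends k v ⊥⊆ (∣⊥∣≡0 n) k+2≡r climb =
    extends⇒flag M (⊂X-flat ⊥⊆ 2+∣⊥∣≤r) (rank-⊥ M) ext ,
    λ (_ , flats , _) → X-notFlat′ (subst (IsFlat M′) Xi (proj₁ (flats (suc i))))
    where
    2+∣⊥∣≤r : 2 + ∣ ⊥ {n} ∣ ≤ r
    2+∣⊥∣≤r = subst₂ _≤_ (cong (2 +_) (sym (∣⊥∣≡0 n))) k+2≡r (m≤n+m 2 k)

  gained⇒climbFrom⊥ : ∀ k → k + 1 ≡ r → ∀ {Xs : Vec (Subset n) (suc (k + 1))} →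
                      Gained Xs → ClimbFrom⊥ X k (⊤ ∷ []) Xs
  gained⇒climbFrom⊥ k k+1≡r {Y ∷ v} gained@(flag , _) with gained⇒near (Y ∷ v) gained
  ... | i , near = Y≡⊥ , extends′⇒climb k v (∣⊥∣≡0 n) k+1≡r (subst (λ A → Extends M′ 1 A v) Y≡⊥ ext)
                           (subst (λ A → Near A ⊎ (∃ λ i → Near (lookup v i))) Y≡⊥ (near-∷⁻ i near))
    where
    ext = flag⇒extends M′ flag
    Y⊂X : Y ⊂ X
    Y⊂X = [ near⇒⊂X , (λ (i , near) → ⊂-trans (extends⇒⊂ M′ 1 v ext i) (near⇒⊂X near)) ]′ (near-∷⁻ i near)
    Y≡⊥ : Y ≡ ⊥
    Y≡⊥ = ∣p∣≡0⇒p≡⊥ (trans (sym (rank′-⊂X Y⊂X)) (proj₂ (proj₁ (proj₂ flag) zero)))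

  climbFrom⊥⇒gained : ∀ k → k + 1 ≡ r → ∀ {Xs : Vec (Subset n) (suc (k + 1))} →
                      ClimbFrom⊥ X k (⊤ ∷ []) Xs → Gained Xs
  climbFrom⊥⇒gained k k+1≡r {Y ∷ v} (refl , climb)
    with ext , i , near ← climb⇒extends′ k v ⊥⊆ (∣⊥∣≡0 n) k+1≡r climb =
    extends⇒flag M′ (⊂X-flat′ ⊥⊂X) (rank-⊥ M′) ext ,
    λ (_ , flats , _) → near-notFlat near (proj₁ (flats i))

  c₁ c₂ : List ℕ
  c₁ = 0 ∷ replicate (r ∸ 1) 1 ++ (n ∸ r + 1) ∷ []
  c₂ = 0 ∷ replicate (r ∸ 2) 1 ++ 2 ∷ (n ∸ r) ∷ []

  ∣⊤─∣ : ∀ (A : Subset n) → ∣ ⊤ ─ A ∣ ≡ n ∸ ∣ A ∣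
  ∣⊤─∣ A = trans (∣p─q∣≡∣p∣∸∣q∣ ⊤ A ⊆⊤) (cong (_∸ ∣ A ∣) (∣⊤∣≡n n))

  gained-composition : ∀ k → k + 1 ≡ r → ∀ {Xs : Vec (Subset n) (suc (k + 1))} →
                       ClimbFrom⊥ X k (⊤ ∷ []) Xs → composition Xs ≡ c₁
  gained-composition k k+1≡r {_ ∷ v} (refl , climb)
    with B , B⊆X , ∣B∣ , eq ← climb-differences X k (⊤ ∷ []) ⊥⊆ climb =
    cong₂ _∷_ (∣⊥∣≡0 n) (trans eq (cong₂ (λ a b → replicate a 1 ++ b ∷ [])
      (sym (trans (cong (_∸ 1) (sym k+1≡r)) (m+n∸n≡m k 1)))
      (trans (∣⊤─∣ B) (trans (cong (n ∸_) ∣B∣≡k) n∸k))))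
    where
    ∣B∣≡k : ∣ B ∣ ≡ k
    ∣B∣≡k = trans ∣B∣ (cong (_+ k) (∣⊥∣≡0 n))
    n∸k : n ∸ k ≡ n ∸ r + 1
    n∸k = trans (cong (_∸ k) (trans (sym (m∸n+n≡m (<⇒≤ (r<n R rk))))
                  (cong (n ∸ r +_) (trans (sym k+1≡r) (+-comm k 1)))))
            (trans (cong (_∸ k) (sym (+-assoc (n ∸ r) 1 k))) (m+n∸n≡m (n ∸ r + 1) k))

  lost-composition : ∀ k → k + 2 ≡ r → ∀ {Xs : Vec (Subset n) (suc (k + 2))} →
                     ClimbFrom⊥ X k (X ∷ ⊤ ∷ []) Xs → composition Xs ≡ c₂
  lost-composition k k+2≡r {_ ∷ v} (refl , climb)
    with B , B⊆X , ∣B∣ , eq ← climb-differences X k (X ∷ ⊤ ∷ []) ⊥⊆ climb =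
    cong₂ _∷_ (∣⊥∣≡0 n) (trans eq (cong₂ _++_
      (cong (λ a → replicate a 1) (sym (trans (cong (_∸ 2) (sym k+2≡r)) (m+n∸n≡m k 2))))
      (cong₂ (λ a b → a ∷ b ∷ [])
        (trans (∣p─q∣≡∣p∣∸∣q∣ X B B⊆X) (trans (cong₂ _∸_
          (trans ∣X∣≡r (sym k+2≡r)) (trans ∣B∣ (cong (_+ k) (∣⊥∣≡0 n))))
          (m+n∸m≡n k 2)))
        (trans (∣⊤─∣ X) (cong (n ∸_) ∣X∣≡r)))))

  flagOf? : ∀ (N : Matroid n) a {l} → Decidable (λ (Xs : Vec (Subset n) (suc l)) → IsFlag N Xs × composition Xs ≡ a)
  flagOf? N a Xs = isFlag? N Xs ×-dec List.≡-dec _≟_ (composition Xs) a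

  lostOf? : ∀ a {l} →
            Decidable (λ (Xs : Vec (Subset n) (suc l)) → (IsFlag M Xs × composition Xs ≡ a) × ¬ IsFlag M′ Xs)
  lostOf? a Xs = flagOf? M a Xs ×-dec ¬? (isFlag? M′ Xs)

  gainedOf? : ∀ a {l} →
              Decidable (λ (Xs : Vec (Subset n) (suc l)) → (IsFlag M′ Xs × composition Xs ≡ a) × ¬ IsFlag M Xs)
  gainedOf? a Xs = flagOf? M′ a Xs ×-dec ¬? (isFlag? M Xs)

  -- The length is a parameter because climbs need it in the form `k + 1` or `k + 2`, to which `r`
  -- is only propositionally equal.
  lostIn gainedIn : ℕ → List ℕ → ℕ
  lostIn   l a = count (lostOf? a) (vectors (subsets n) (suc l))
  gainedIn l a = count (gainedOf? a) (vectors (subsets n) (suc l))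

  lost gained : List ℕ → ℕ
  lost   = lostIn r
  gained = gainedIn r

  -- Both sides count the vectors of composition `a` that are flags of at least one of the two
  -- matroids. In this form no subtraction of natural numbers occurs.
  ν-balance : ∀ a → ν M′ a + lost a ≡ ν M a + gained a
  ν-balance a = begin
    ν M′ a + lost a               ≡⟨ cong (_+ lost a)
      (trans (ν-count M′ rk′ a) (count-split (flagOf? M′ a) (isFlag? M) Xss)) ⟩
    (both′ + gained a) + lost a   ≡⟨ cong (λ b → (b + gained a) + lost a) (count-cong
      (λ Xs → flagOf? M′ a Xs ×-dec isFlag? M Xs) (λ Xs → flagOf? M a Xs ×-dec isFlag? M′ Xs) swap swap Xss) ⟩
    (both + gained a) + lost a    ≡⟨ +-assoc both (gained a) (lost a) ⟩
    both + (gained a + lost a)    ≡⟨ cong (both +_) (+-comm (gained a) (lost a)) ⟩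
    both + (lost a + gained a)    ≡⟨ +-assoc both (lost a) (gained a) ⟨
    (both + lost a) + gained a    ≡⟨ cong (_+ gained a)
      (trans (ν-count M rk a) (count-split (flagOf? M a) (isFlag? M′) Xss)) ⟨
    ν M a + gained a              ∎
    where
    open ≡-Reasoning
    Xss = vectors (subsets n) (suc r)
    both both′ : ℕ
    both  = count (λ Xs → flagOf? M a Xs ×-dec isFlag? M′ Xs) Xss
    both′ = count (λ Xs → flagOf? M′ a Xs ×-dec isFlag? M Xs) Xss
    swap : ∀ {p q s} {P : Set p} {Q : Set q} {S : Set s} → (P × Q) × S → (S × Q) × P
    swap ((p , q) , s) = (s , q) , p

  module _ (k : ℕ) (k+1≡r : k + 1 ≡ r) where

    gained-≢c₁ : ∀ a → a ≢ c₁ → gained a ≡ 0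
    gained-≢c₁ a a≢c₁ = subst (λ l → gainedIn l a ≡ 0) k+1≡r (count-none (gainedOf? a)
      (λ ((flag′ , comp) , ¬flag) → a≢c₁ (trans (sym comp)
        (gained-composition k k+1≡r (gained⇒climbFrom⊥ k k+1≡r (flag′ , ¬flag)))))
      (vectors (subsets n) (suc (k + 1))))

    gained-c₁ : gained c₁ ≡ r !
    gained-c₁ = begin
      gained c₁                ≡⟨ cong (λ l → gainedIn l c₁) k+1≡r ⟨
      gainedIn (k + 1) c₁      ≡⟨ count-cong (gainedOf? c₁) climbs?
                                    (λ ((flag′ , _) , ¬flag) → gained⇒climbFrom⊥ k k+1≡r (flag′ , ¬flag))
                                    (λ climb → let flag′ , ¬flag = climbFrom⊥⇒gained k k+1≡r climb in
                                      (flag′ , gained-composition k k+1≡r climb) , ¬flag)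
                                    Xss ⟩
      count climbs? Xss        ≡⟨ count-climbFrom⊥ X k (⊤ ∷ []) ⟩
      falling ∣ X ∣ k             ≡⟨ cong (λ d → falling d k) (trans ∣X∣≡r (sym k+1≡r)) ⟩
      falling (k + 1) k           ≡⟨ *-identityʳ _ ⟨
      falling (k + 1) k * 1       ≡⟨ falling-! 1 k ⟩
      (k + 1) !                ≡⟨ cong _! k+1≡r ⟩
      r !                      ∎
      where
      open ≡-Reasoning
      Xss     = vectors (subsets n) (suc (k + 1))
      climbs? = climbFrom⊥? X k (⊤ ∷ [])

  module _ (k : ℕ) (k+2≡r : k + 2 ≡ r) where

    lost-≢c₂ : ∀ a → a ≢ c₂ → lost a ≡ 0
    lost-≢c₂ a a≢c₂ = subst (λ l → lostIn l a ≡ 0) k+2≡r (count-none (lostOf? a)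
      (λ ((flag , comp) , ¬flag′) → a≢c₂ (trans (sym comp)
        (lost-composition k k+2≡r (lost⇒climbFrom⊥ k k+2≡r (flag , ¬flag′)))))
      (vectors (subsets n) (suc (k + 2))))

    -- The two orders in which the last two elements of `X` could enter give the same lost flag, so
    -- each flag stands for two orderings of `X`.
    lost-c₂*2 : lost c₂ * 2 ≡ r !
    lost-c₂*2 = begin
      lost c₂ * 2              ≡⟨ cong (λ l → lostIn l c₂ * 2) k+2≡r ⟨
      lostIn (k + 2) c₂ * 2    ≡⟨ cong (_* 2) (count-cong (lostOf? c₂) climbs?
                                    (λ ((flag , _) , ¬flag′) → lost⇒climbFrom⊥ k k+2≡r (flag , ¬flag′))
                                    (λ climb → let flag , ¬flag′ = climbFrom⊥⇒lost k k+2≡r climb in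
                                      (flag , lost-composition k k+2≡r climb) , ¬flag′)
                                    Xss) ⟩
      count climbs? Xss * 2    ≡⟨ cong (_* 2) (count-climbFrom⊥ X k (X ∷ ⊤ ∷ [])) ⟩
      falling ∣ X ∣ k * 2         ≡⟨ cong (λ d → falling d k * 2) (trans ∣X∣≡r (sym k+2≡r)) ⟩
      falling (k + 2) k * 2       ≡⟨ falling-! 2 k ⟩
      (k + 2) !                ≡⟨ cong _! k+2≡r ⟩
      r !                      ∎
      where
      open ≡-Reasoning
      Xss     = vectors (subsets n) (suc (k + 2))
      climbs? = climbFrom⊥? X k (X ∷ ⊤ ∷ [])

    -- After the leading 0 and `k` ones, the next entry is 1 in `c₁` and 2 in `c₂`.
    c₁≢c₂ : c₁ ≢ c₂
    c₁≢c₂ eq = go k (List.∷-injectiveʳ (subst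
      (λ s → 0 ∷ replicate (s ∸ 1) 1 ++ (n ∸ r + 1) ∷ [] ≡ 0 ∷ replicate (s ∸ 2) 1 ++ 2 ∷ (n ∸ r) ∷ [])
      (trans (sym k+2≡r) (+-comm k 2)) eq))
      where
      go : ∀ k {x y : ℕ} → replicate (suc k) 1 ++ x ∷ [] ≢ replicate k 1 ++ 2 ∷ y ∷ []
      go zero    ()
      go (suc k) eq = go k (List.∷-injectiveʳ eq)

  lost-c₁ : lost c₁ ≡ 0
  lost-c₁ = by-cases (r ≟ 1)
    where
    -- For r = 1 the flag lost is X ⊂ ⊤; a composition starting with 0 would force ⊥ to be a flat.
    none : r ≡ 1 → ∀ {Xs : Vec (Subset n) (suc r)} → ¬ ((IsFlag M Xs × composition Xs ≡ c₁) × ¬ IsFlag M′ Xs)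
    none r≡1 {Y ∷ v} (((_ , flats , _) , comp) , _) =
      near-notFlat (subst Near (sym (∣p∣≡0⇒p≡⊥ {p = Y} (List.∷-injectiveˡ comp)))
                     (⊥⊆ , trans (cong suc (∣⊥∣≡0 n)) (sym r≡1)))
                   (proj₁ (flats zero))
    by-cases : Dec (r ≡ 1) → lost c₁ ≡ 0
    by-cases (yes r≡1) = count-none (lostOf? c₁) (none r≡1) (vectors (subsets n) (suc r))
    by-cases (no r≢1)  = lost-≢c₂ (r ∸ 2) r≡ c₁ (c₁≢c₂ (r ∸ 2) r≡)
      where
      r≡ : (r ∸ 2) + 2 ≡ r
      r≡ = m∸n+n≡m (≤∧≢⇒< (0<r R rk) (r≢1 ∘ sym))

  r∸1+1≡r : (r ∸ 1) + 1 ≡ r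
  r∸1+1≡r = m∸n+n≡m (0<r R rk)

  open Balance (List.≡-dec _≟_) (ν M) (ν M′) lost gained {c₁} {c₂} (1≤n! r) ν-balance
    (gained-≢c₁ (r ∸ 1) r∸1+1≡r) (gained-c₁ (r ∸ 1) r∸1+1≡r) lost-c₁

  ν-c₁ : ν M′ c₁ ≡ ν M c₁ + r !
  ν-c₁ = f-x

  module _ (2≤r : 2 ≤ r) where

    private
      r∸2+2≡r : (r ∸ 2) + 2 ≡ r
      r∸2+2≡r = m∸n+n≡m 2≤r

    ν-c₂ : ℤ.+ ν M′ c₂ ≡ ℤ.+ ν M c₂ ℤ.- ℤ.+ (r ! / 2)
    ν-c₂ = f-y-ℤ (c₁≢c₂ (r ∸ 2) r∸2+2≡r) (lost-≢c₂ (r ∸ 2) r∸2+2≡r) (lost-c₂*2 (r ∸ 2) r∸2+2≡r)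

    ν-≢⇔ : ∀ a → (ν M′ a ≢ ν M a) ⇔ (a ≡ c₁ ⊎ a ≡ c₂)
    ν-≢⇔ = f-≢⇔ (c₁≢c₂ (r ∸ 2) r∸2+2≡r) (lost-≢c₂ (r ∸ 2) r∸2+2≡r) (lost-c₂*2 (r ∸ 2) r∸2+2≡r)

open import Data.Integer.Base using (+_)

proposition4p16 :
  ∀ {c ℓ₁ ℓ₂} (K : HeytingField c ℓ₁ ℓ₂) → CharacteristicZero K →
  ∀ {n r} (M M′ : Matroid n) (X : Subset n)
  (rk : rank M ⊤ ≡ r) (R : IsRelaxation M X M′) →
  let open 𝒢 K {n} {r}
      c₁ = 0 ∷ replicate (r ∸ 1) 1 ++ (n ∸ r + 1) ∷ []
      c₂ = 0 ∷ replicate (r ∸ 2) 1 ++ 2 ∷ (n ∸ r) ∷ []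
  in
    (𝒢-invariant M′ (relaxation-rank R rk) -ᴹ 𝒢-invariant M rk
      ≈ᴹ fromℕ K (r ! * (n ∸ r) !) *ₗ
           ([ 1^ r ++ 0^ (n ∸ r) , 1^r0^[n-r]-isWord (r<n R rk) ]
             -ᴹ [ 1^ (r ∸ 1) ++ 0 ∷ 1 ∷ 0^ (n ∸ r ∸ 1)
                  , 1^[r-1]010^[n-r-1]-isWord (0<r R rk) (r<n R rk) ]))
  × (ν M′ c₁ ≡ ν M c₁ + r !)
  × (2 ≤ r →
      (+ ν M′ c₂ ≡ + ν M c₂ ℤ.- + (r ! / 2))
    × (∀ a → IsComposition n r a → (ν M′ a ≢ ν M a) ⇔ (a ≡ c₁ ⊎ a ≡ c₂)))
proposition4p16 K _ M M′ X rk R = 𝒢-difference K rk R , ν-c₁ , λ 2≤r → ν-c₂ 2≤r , λ a _ → ν-≢⇔ 2≤r a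
  where open FlagCounts R rk
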